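{- Let $\sigma:\Sigma\to\Sigma$ be a shift of finite type. Then there exist a positive integer $m$ and a finite collection $\mathcal P$ of prototiles such that the tiling system $\sigma:T\to T$, $T=T(\mathcal P)$, satisfies: (1) $T=T_0\cup T_1\cup\dots\cup T_{m-1}$, where the sets $T_i$ are closed and cyclically permuted by the shift $\sigma$ (i.e. $\sigma(T_i)=T_{i+1}$ for $0\le i<m-1$ and $\sigma(T_{m-1})=T_0$); (2) $\sigma^m:\Sigma\to\Sigma$ is topologically conjugate to $\sigma^m:T_i\to T_i$ for every $i\in\{0,\dots,m-1\}$.
   Context: A prototile is a finite nonempty subset of $\mathbb Z$ with minimum $0$. Let $\mathcal P=\{P_1,\dots,P_K\}$ be a finite collection of prototiles. A tile is a translate $t+P_k$ ($t\in\mathbb Z$). A tiling of the integers by $\mathcal P$ is an expression of $\mathbb Z$ as a disjoint union of tiles, $\mathbb Z=\bigcup_j (t_j+P_{k_j})$. To such a tiling corresponds the point $x=(x_i)\in\{1,\dots,K\}^{\mathbb Z}$ defined by $x_i=k$ iff there is $j$ with $i\in t_j+P_{k_j}$ and $k_j=k$. $T(\mathcal P)$ denotes the set of all points corresponding to tilings of $\mathbb Z$ by $\mathcal P$; it is closed and shift-invariant, where $\sigma$ is the shift $(\sigma(x))_i=x_{i+1}$. The map $\sigma:T(\mathcal P)\to T(\mathcal P)$ is called a tiling system. -}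

module Defs where

open import Level using (Level; _⊔_; 0ℓ) renaming (suc to lsuc)
open import Data.Nat.Base using (ℕ; NonZero) renaming (_≤_ to _≤ⁿ_)
open import Data.Nat.GeneralisedArithmetic using (iterate)
open import Data.Integer.Base using (ℤ; 0ℤ; 1ℤ; +_; _+_; _≤_; ∣_∣)
open import Data.Fin.Base using (Fin; toℕ)
open import Data.List.Base using (List; length; lookup)
open import Data.List.Membership.Propositional using (_∈_)
open import Data.List.Relation.Unary.All using (All)
open import Data.Product using (∃; ∃-syntax; _×_; _,_; proj₁; proj₂)
open import Function.Bundles using (_⇔_)
open import Function.Definitions using (Injective)
open import Relation.Binary.PropositionalEquality using (_≡_; _≗_)
open import Relation.Nullary using (¬_)
open import Relation.Unary using (Pred; _≐_) renaming (_∈_ to _∈ₛ_)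

------------------------------------------------------------------------
-- Symbolic dynamics

Point : ℕ → Set
Point n = ℤ → Fin n

σ : ∀ {n} → Point n → Point n
σ x i = x (i + 1ℤ)

σ^ : ∀ {n} → ℕ → Point n → Point n
σ^ m x = iterate σ x m

-- The direct image σ(S).  Points are compared pointwise (_≗_), since
-- function extensionality is not available.
σ[_] : ∀ {n ℓ} → Pred (Point n) ℓ → Pred (Point n) ℓ
σ[ S ] y = ∃[ x ] (x ∈ₛ S × σ x ≗ y)

-- x and y agree on the window [-N , N].  For fixed x these sets of y are
-- the basic neighbourhoods of x in the product of discrete topologies.
Agree : ∀ {n} → ℕ → Point n → Point n → Set
Agree N x y = ∀ i → ∣ i ∣ ≤ⁿ N → x i ≡ y i

-- S contains every point all of whose neighbourhoods meet S.  In
-- particular a closed set is invariant under _≗_.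
Closed : ∀ {n ℓ} → Pred (Point n) ℓ → Set ℓ
Closed S = ∀ x → (∀ N → ∃[ y ] (y ∈ₛ S × Agree N x y)) → x ∈ₛ S

-- Continuity for the subspace topologies.  It implies that φ respects _≗_
-- and hence does not depend on the membership proofs.
Continuous : ∀ {n k ℓ₁ ℓ₂} {S : Pred (Point n) ℓ₁} {T : Pred (Point k) ℓ₂} →
             (∃ S → ∃ T) → Set ℓ₁
Continuous φ = ∀ x N → ∃[ M ] (∀ y → Agree M (proj₁ x) (proj₁ y) →
                                     Agree N (proj₁ (φ x)) (proj₁ (φ y)))

-- f and g restrict to maps f : S → S and g : T → T, and these are
-- topologically conjugate.
record Conjugate {n k : ℕ} {ℓ₁ ℓ₂ : Level}
                 (f : Point n → Point n) (S : Pred (Point n) ℓ₁)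
                 (g : Point k → Point k) (T : Pred (Point k) ℓ₂)
                 : Set (ℓ₁ ⊔ ℓ₂) where
  field
    f-maps          : ∀ x → x ∈ₛ S → f x ∈ₛ S
    g-maps          : ∀ y → y ∈ₛ T → g y ∈ₛ T
    to              : ∃ S → ∃ T
    from            : ∃ T → ∃ S
    to∘from         : ∀ y → proj₁ (to (from y)) ≗ proj₁ y
    from∘to         : ∀ x → proj₁ (from (to x)) ≗ proj₁ x
    to-continuous   : Continuous {S = S} {T = T} to
    from-continuous : Continuous {S = T} {T = S} from
    commutes        : ∀ x (x∈S : x ∈ₛ S) →
                      proj₁ (to (f x , f-maps x x∈S)) ≗ g (proj₁ (to (x , x∈S)))

OccursAt : ∀ {n} → List (Fin n) → Point n → ℤ → Set
OccursAt w x i = ∀ (p : Fin (length w)) → x (i + + toℕ p) ≡ lookup w p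

Avoiding : ∀ {n} → List (List (Fin n)) → Pred (Point n) 0ℓ
Avoiding F x = ∀ w → w ∈ F → ∀ i → ¬ OccursAt w x i

IsShiftOfFiniteType : ∀ {n ℓ} → Pred (Point n) ℓ → Set ℓ
IsShiftOfFiniteType {n} S = ∃[ F ] (S ≐ Avoiding {n} F)

------------------------------------------------------------------------
-- Tilings of the integers

-- The underlying set is the set of entries of the list; order and
-- repetitions are irrelevant.
record Prototile : Set where
  field
    elements : List ℤ
    0∈       : 0ℤ ∈ elements
    0≤       : All (0ℤ ≤_) elements

open Prototile public

-- Equality of prototiles as subsets of ℤ.
_≋_ : Prototile → Prototile → Set
P ≋ Q = ∀ i → (i ∈ elements P) ⇔ (i ∈ elements Q)

-- A finite set {P₁, …, P_K} of prototiles, enumerated without repetition.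
record Collection : Set where
  field
    size      : ℕ
    nonempty  : NonZero size
    prototile : Fin size → Prototile
    distinct  : Injective _≡_ _≋_ prototile

open Collection public

-- The translate t + P.
tile : ℤ → Prototile → Pred ℤ 0ℓ
tile t P i = ∃[ p ] (p ∈ elements P × i ≡ t + p)

record Tiling (𝒫 : Collection) : Set₁ where
  field
    Index    : Set
    position : Index → ℤ
    kind     : Index → Fin (size 𝒫)

  tileAt : Index → Pred ℤ 0ℓ
  tileAt j = tile (position j) (prototile 𝒫 (kind j))

  field
    covers   : ∀ i → ∃[ j ] (i ∈ₛ tileAt j)
    disjoint : ∀ {i j j′} → i ∈ₛ tileAt j → i ∈ₛ tileAt j′ → j ≡ j′

CorrespondsTo : ∀ {𝒫} → Tiling 𝒫 → Pred (Point (size 𝒫)) 0ℓ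
CorrespondsTo τ x = ∀ i k → (x i ≡ k) ⇔ (∃[ j ] (i ∈ₛ tileAt j × kind j ≡ k))
  where open Tiling τ

TilingSystem : (𝒫 : Collection) → Pred (Point (size 𝒫)) (lsuc 0ℓ)
TilingSystem 𝒫 x = ∃[ τ ] CorrespondsTo {𝒫} τ x

{-# OPTIONS --safe #-}

-- Cut the line into frames of m cells, and call the beginning of the word
-- that a point of Σ shows on a frame the state of that frame; it is just long
-- enough to decide which words may precede it.  A frame from state u to state
-- v is tiled by one large tile, the master, and by slaves.  The master ends in
-- a tail that reaches into the next frame and whose length shows v; the tail
-- has to fill a gap in the next master, whose length shows the state of the
-- next frame.  The master has equally many holes on its left and on its right
-- side, and a slave consists of two translates of {0, 1, 3}, so far apart that
-- they fill a left and a right hole of the same frame.  Since {0, 1, 3} is no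
-- tile of ℤ, slaves can only lie in holes, and this forces every tiling into
-- frames.  A master with h holes on each side can be completed in h! ways.  So
-- write the number of words from u to v in the factorial number system and
-- provide as many masters with h holes as the digit of h! prescribes: the
-- frames from u to v are then in bijection with the words from u to v.  This
-- works because the frame length m is linear in the largest number ℓ of holes,
-- whence there are at most n ^ m < (ℓ + 1)! words.

module Submission where

open import Defs
open import Level using (Level; Lift; lift; 0ℓ) renaming (suc to lsuc)
open import Algebra.Properties.AbelianGroup using (∙-cancelˡ; ∙-cancelʳ)
open import Axiom.UniquenessOfIdentityProofs using (UIP; module Decidable⇒UIP)
open import Data.Bool.Base using (Bool; true; false; T)
open import Data.Bool.Properties as Bool using (T?)
open import Data.Empty using (⊥; ⊥-elim)
open import Data.Fin.Base as Fin using (Fin; zero; suc; toℕ; fromℕ; fromℕ<; inject₁; punchIn; punchOut)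
open import Data.Fin.Patterns
open import Data.Fin.Properties as Fin using (injective⇒≤; +↔⊎; *↔×; punchIn-injective; punchInᵢ≢i; punchIn-punchOut; punchOut-injective)
open import Data.Integer.Base as ℤ using (ℤ; 0ℤ; 1ℤ; -1ℤ; ∣_∣)
import Data.Integer.DivMod as ℤ
import Data.Integer.Properties as ℤ
open import Data.Integer.Tactic.RingSolver using (solve-∀)
open import Data.List.Base using (List; _∷_; length; lookup; map; filter; cartesianProduct; upTo; allFin)
open import Data.List.Membership.Propositional using (_∈_)
open import Data.List.Membership.Propositional.Properties
open import Data.List.Relation.Unary.All as All using (All)
open import Data.List.Relation.Unary.Any using (here; there)
open import Data.Maybe.Base using (Maybe; just; nothing)
open import Data.Maybe.Properties using (just-injective) renaming (≡-dec to Maybe-≡-dec)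
open import Data.Nat.Base as ℕ using (ℕ; zero; suc; _+_; _*_; _^_; _!; _≤_; _<_; _/_; _%_; z≤n; s≤s; NonZero)
open import Data.Nat.ListAction using (sum)
open import Data.Nat.DivMod as ℕ using (m≡m%n+[m/n]*n; m%n<n; m<n*o⇒m/o<n)
open import Data.Nat.Properties as ℕ
import Data.Nat.Tactic.RingSolver as ℕ-Solver
open import Data.Product using (Σ; ∃; ∃-syntax; Σ-syntax; _×_; _,_; proj₁; proj₂)
open import Data.Product.Function.NonDependent.Propositional using (_×-↔_)
open import Data.Sum.Base using (_⊎_; inj₁; inj₂)
open import Data.Sum.Function.Propositional using (_⊎-↔_)
open import Data.Unit.Base using (⊤; tt)
open import Data.Vec.Base as Vec using (Vec; []; _∷_; _++_; truncate)
open import Function.Base using (_∘_)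
open import Function.Bundles using (_↔_; Inverse; Equivalence; mk⇔; mk↔ₛ′)
open import Function.Construct.Composition using (_↔-∘_)
open import Function.Construct.Identity using (↔-id)
open import Function.Construct.Symmetry using (⇔-sym)
open import Function.Definitions using (Injective)
open import Relation.Binary.Definitions using (tri<; tri≈; tri>)
open import Relation.Binary.PropositionalEquality
open import Relation.Nullary using (¬_; Dec; yes; no; does; contradiction)
open import Relation.Nullary.Decidable using (map′; _×-dec_; _⊎-dec_; ¬?; dec-true)
open import Relation.Unary using (Pred; _≐_; ⋃)

-- Finite types

-- A collection contains no prototile twice, so masters cannot simply be labelled with words: all
-- information has to show in shapes. The shapes of masters are too few. A frame has 2 ^ m subsets,
-- while the number of words between two states may be of the order of n ^ m, and a larger m does
-- not help when n > 2. The number of ways to place the slaves, however, outgrows every exponential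
-- in m. Masters with the same states and the same number h of holes on each side still have to
-- differ in shape. They do so by the displacement of the block of left holes. A displacement costs
-- room, so the number of such masters has to be small; this is where the factorial system fits, its
-- digit at h ! being at most h. Hence displacements stay below ℓ and the frame length stays linear
-- in ℓ.

Finite : Set → Set
Finite A = ∃[ s ] (Fin s ↔ A)

card : ∀ {A} → Finite A → ℕ
card = proj₁

module _ {A : Set} (fin : Finite A) where
  index : A → Fin (card fin)
  index = Inverse.from (proj₂ fin)

  element : Fin (card fin) → A
  element = Inverse.to (proj₂ fin)

  element-index : ∀ a → element (index a) ≡ a
  element-index = Inverse.strictlyInverseˡ (proj₂ fin)

  index-element : ∀ k → index (element k) ≡ k
  index-element = Inverse.strictlyInverseʳ (proj₂ fin)

  element-injective : ∀ {k k′} → element k ≡ element k′ → k ≡ k′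
  element-injective {k} {k′} eq =
    trans (sym (index-element k)) (trans (cong index eq) (index-element k′))

↔-finite : ∀ {A B} → A ↔ B → Finite A → Finite B
↔-finite f (n , g) = n , (f ↔-∘ g)

Fin-finite : ∀ n → Finite (Fin n)
Fin-finite n = n , ↔-id _

⊎-finite : ∀ {A B} → Finite A → Finite B → Finite (A ⊎ B)
⊎-finite (a , f) (b , g) = a + b , ((f ⊎-↔ g) ↔-∘ +↔⊎)

Σ-suc : ∀ {n} (B : Fin (suc n) → Set) → (B zero ⊎ Σ (Fin n) (B ∘ suc)) ↔ Σ (Fin (suc n)) B
Σ-suc _ = mk↔ₛ′
  (λ { (inj₁ b) → zero , b ; (inj₂ (k , b)) → suc k , b })
  (λ { (zero , b) → inj₁ b ; (suc k , b) → inj₂ (k , b) })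
  (λ { (zero , b) → refl ; (suc k , b) → refl })
  (λ { (inj₁ b) → refl ; (inj₂ (k , b)) → refl })

ΣFin-finite : ∀ n {B : Fin n → Set} → (∀ k → Finite (B k)) → Finite (Σ (Fin n) B)
ΣFin-finite zero    f = 0 , mk↔ₛ′ (λ ()) (λ { (() , _) }) (λ { (() , _) }) (λ ())
ΣFin-finite (suc n) {B} f = ↔-finite (Σ-suc B) (⊎-finite (f zero) (ΣFin-finite n (f ∘ suc)))

-- The inverse transports the second component along `element-index`. The round trip therefore
-- compares two proofs of one equation in `A`; they agree because the numbering makes equality on
-- `A` decidable.
Σ-finite : ∀ {A} {B : A → Set} → Finite A → (∀ a → Finite (B a)) → Finite (Σ A B)
Σ-finite {A} {B} fin@(n , f) g = ↔-finite (mk↔ₛ′ to from to∘from from∘to) (ΣFin-finite n (g ∘ element fin))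
  where
  to : Σ (Fin n) (B ∘ element fin) → Σ A B
  to (k , b) = element fin k , b
  from : Σ A B → Σ (Fin n) (B ∘ element fin)
  from (a , b) = index fin a , subst B (sym (element-index fin a)) b
  ,-subst : ∀ {a a′} (eq : a ≡ a′) {b} → _≡_ {A = Σ A B} (a , subst B (sym eq) b) (a′ , b)
  ,-subst refl = refl
  to∘from : ∀ x → to (from x) ≡ x
  to∘from (a , b) = ,-subst (element-index fin a)
  ,-≡ : ∀ {k k′} (eq : k ≡ k′) {b b′} → (∀ e → subst B (sym e) b′ ≡ b) →
        _≡_ {A = Σ (Fin n) (B ∘ element fin)} (k , b) (k′ , b′)
  ,-≡ refl e = cong (_ ,_) (sym (e refl))
  from∘to : ∀ x → from (to x) ≡ x
  from∘to (k , b) = ,-≡ (index-element fin k)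
    (λ e → cong (λ e′ → subst B (sym e′) b) (UIP-A e _))
    where
    UIP-A : UIP A
    UIP-A = Decidable⇒UIP.≡-irrelevant dec
      where
      dec : ∀ a a′ → Dec (a ≡ a′)
      dec a a′ with index fin a Fin.≟ index fin a′
      ... | yes eq = yes (trans (sym (element-index fin a)) (trans (cong (element fin) eq) (element-index fin a′)))
      ... | no neq = no (neq ∘ cong (index fin))

×-finite : ∀ {A B} → Finite A → Finite B → Finite (A × B)
×-finite (a , f) (b , g) = a * b , ((f ×-↔ g) ↔-∘ *↔×)

≡true-finite : ∀ b → Finite (b ≡ true)
≡true-finite false = 0 , mk↔ₛ′ (λ ()) (λ ()) (λ ()) (λ ())
≡true-finite true  = 1 , mk↔ₛ′ (λ _ → refl) (λ _ → zero) (λ { refl → refl }) (λ { zero → refl })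

Vec-finite : ∀ {A} → Finite A → ∀ n → Finite (Vec A n)
Vec-finite fin zero    = 1 , mk↔ₛ′ (λ _ → []) (λ _ → zero) (λ { [] → refl }) (λ { zero → refl })
Vec-finite fin (suc n) = ↔-finite
  (mk↔ₛ′ (λ { (a , as) → a ∷ as }) (λ { (a ∷ as) → a , as })
         (λ { (a ∷ as) → refl }) (λ { (a , as) → refl }))
  (×-finite fin (Vec-finite fin n))

card-Vec : ∀ {A} (fin : Finite A) n → card (Vec-finite fin n) ≡ card fin ^ n
card-Vec fin zero    = refl
card-Vec fin (suc n) = cong (card fin *_) (card-Vec fin n)

card-≤ : ∀ {A B} (a : Finite A) (b : Finite B) (f : A → B) → Injective _≡_ _≡_ f → card a ≤ card b
card-≤ a b f f-inj = injective⇒≤ {f = index b ∘ f ∘ element a}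
  λ eq → element-injective a (f-inj (trans (sym (element-index b _)) (trans (cong (element b) eq) (element-index b _))))

-- Permutations

-- Lehmer codes: the head is the image of 0, and the tail permutes the n values that are left. The
-- count n ! can be read off the type.
data Code : ℕ → Set where
  []  : Code 0
  _∷_ : ∀ {n} → Fin (suc n) → Code n → Code (suc n)

decode : ∀ {n} → Code n → Fin n → Fin n
decode (p ∷ c) zero    = p
decode (p ∷ c) (suc a) = punchIn p (decode c a)

decode-injective : ∀ {n} (c : Code n) → Injective _≡_ _≡_ (decode c)
decode-injective (p ∷ c) {zero}  {zero}  eq = refl
decode-injective (p ∷ c) {zero}  {suc b} eq = contradiction (sym eq) (punchInᵢ≢i p _)
decode-injective (p ∷ c) {suc a} {zero}  eq = contradiction eq (punchInᵢ≢i p _)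
decode-injective (p ∷ c) {suc a} {suc b} eq =
  cong suc (decode-injective c (punchIn-injective p _ _ eq))

decode-surjective : ∀ {n} (c : Code n) b → ∃[ a ] decode c a ≡ b
decode-surjective (p ∷ c) b with p Fin.≟ b
... | yes p≡b = zero , p≡b
... | no  p≢b with decode-surjective c (punchOut p≢b)
...   | a , eq = suc a , trans (cong (punchIn p) eq) (punchIn-punchOut p≢b)

decode-cancel : ∀ {n} (c c′ : Code n) → (∀ a → decode c a ≡ decode c′ a) → c ≡ c′
decode-cancel []      []        eq = refl
decode-cancel (p ∷ c) (p′ ∷ c′) eq with eq zero
... | refl = cong (p ∷_) (decode-cancel c c′ (λ a → punchIn-injective p _ _ (eq (suc a))))

injective⇒decode : ∀ {n} (f : Fin n → Fin n) → Injective _≡_ _≡_ f → ∃[ c ] (∀ a → decode c a ≡ f a)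
injective⇒decode {zero}  f f-inj = [] , λ ()
injective⇒decode {suc n} f f-inj = f zero ∷ proj₁ rest , λ
  { zero → refl
  ; (suc a) → trans (cong (punchIn (f zero)) (proj₂ rest a)) (punchIn-punchOut (≢f0 a)) }
  where
  ≢f0 : ∀ a → f zero ≢ f (suc a)
  ≢f0 a eq with f-inj eq
  ... | ()
  rest = injective⇒decode (λ a → punchOut (≢f0 a))
    (λ eq → Fin.suc-injective (f-inj (punchOut-injective (≢f0 _) (≢f0 _) eq)))

Code-finite : ∀ n → Fin (n !) ↔ Code n
Code-finite zero    = mk↔ₛ′ (λ _ → []) (λ _ → zero) (λ { [] → refl }) (λ { zero → refl })
Code-finite (suc n) = mk↔ₛ′ (λ { (p , c) → p ∷ c }) (λ { (p ∷ c) → p , c }) (λ { (p ∷ c) → refl }) (λ { (p , c) → refl })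
  ↔-∘ ((↔-id _ ×-↔ Code-finite n) ↔-∘ *↔×)

-- The factorial number system, the most significant digit coming first.

-- The weights are 1 !, ..., ℓ !. As 0 ! is left out, every master has at least one hole on each
-- side.
holes : ∀ {ℓ} → Fin ℓ → ℕ
holes {suc ℓ} zero    = suc ℓ
holes {suc ℓ} (suc i) = holes i

0<holes : ∀ {ℓ} (i : Fin ℓ) → 0 < holes i
0<holes {suc ℓ} zero    = s≤s z≤n
0<holes {suc ℓ} (suc i) = 0<holes i

holes≤ : ∀ {ℓ} (i : Fin ℓ) → holes i ≤ ℓ
holes≤ {suc ℓ} zero    = ≤-refl
holes≤ {suc ℓ} (suc i) = m≤n⇒m≤1+n (holes≤ i)

holes-injective : ∀ {ℓ} {i j : Fin ℓ} → holes i ≡ holes j → i ≡ j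
holes-injective {suc ℓ} {zero}  {zero}  eq = refl
holes-injective {suc ℓ} {zero}  {suc j} eq = contradiction (holes≤ j) (<⇒≱ (≤-reflexive eq))
holes-injective {suc ℓ} {suc i} {zero}  eq = contradiction (holes≤ i) (<⇒≱ (≤-reflexive (sym eq)))
holes-injective {suc ℓ} {suc i} {suc j} eq = cong suc (holes-injective eq)

Numeral : ∀ {ℓ} → (Fin ℓ → ℕ) → Set
Numeral {ℓ} dig = Σ[ i ∈ Fin ℓ ] (Fin (dig i) × Code (holes i))

-- Division by the largest weight. From K < (ℓ + 2) * (ℓ + 1) ! the quotient is at most ℓ + 1, the
-- number of holes that goes with this weight, and the remainder is small enough for the recursion.
numeral : ∀ ℓ K → K < suc ℓ ! →
          Σ[ dig ∈ (Fin ℓ → ℕ) ] ((∀ i → dig i ≤ holes i) × (Fin K ↔ Numeral dig))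
numeral zero    zero    _ = (λ ()) , (λ ()) , mk↔ₛ′ (λ ()) (λ { (() , _) }) (λ { (() , _) }) (λ ())
numeral zero    (suc K) (s≤s ())
numeral (suc ℓ) K K< =
  dig , dig≤ ,
  (Σ-suc (λ i → Fin (dig i) × Code (holes i)) ↔-∘ (((↔-id _ ×-↔ Code-finite (suc ℓ)) ↔-∘ *↔×) ⊎-↔ proj₂ (proj₂ rest)))
  ↔-∘ (+↔⊎ ↔-∘ subst (λ k → Fin K ↔ Fin k) K≡ (↔-id _))
  where
  instance _ = suc ℓ !≢0
  rest = numeral ℓ (K % suc ℓ !) (m%n<n K (suc ℓ !))
  dig : Fin (suc ℓ) → ℕ
  dig zero    = K / suc ℓ !
  dig (suc i) = proj₁ rest i
  dig≤ : ∀ i → dig i ≤ holes i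
  dig≤ zero    = ℕ.s≤s⁻¹ (m<n*o⇒m/o<n {n = suc (suc ℓ)} K<)
  dig≤ (suc i) = proj₁ (proj₂ rest) i
  K≡ : K ≡ K / suc ℓ ! * suc ℓ ! + K % suc ℓ !
  K≡ = trans (m≡m%n+[m/n]*n K (suc ℓ !)) (+-comm (K % suc ℓ !) _)

-- The last t factors of (k + t) ! are k + 1, ..., k + t.
^-≤-! : ∀ k t → suc k ^ t ≤ (k + t) !
^-≤-! k zero    = ≤-trans (1≤n! k) (≤-reflexive (cong _! (sym (+-identityʳ k))))
^-≤-! k (suc t) = ≤-trans (*-mono-≤ (s≤s (m≤m+n k t)) (^-≤-! k t))
                          (≤-reflexive (cong _! (sym (+-suc k t))))

n<2^n : ∀ n → n < 2 ^ n
n<2^n zero    = s≤s z≤n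
n<2^n (suc n) = ≤-trans (+-mono-≤ (m^n>0 2 n) (n<2^n n)) (≤-reflexive (cong (2 ^ n +_) (sym (+-identityʳ _))))

^-distribʳ-* : ∀ a b t → (a * b) ^ t ≡ a ^ t * b ^ t
^-distribʳ-* a b zero    = refl
^-distribʳ-* a b (suc t) = trans (cong (a * b *_) (^-distribʳ-* a b t)) ([m*n]*[o*p]≡[m*o]*[n*p] a b (a ^ t) (b ^ t))

-- The witness is k + t with suc k = 2 * suc b: each of the t factors exceeding
-- k contributes 2 * suc b, and 2 ^ t pays for a * b ^ k.
factorial-dominates : ∀ a b → ∃[ ℓ ] (0 < ℓ × a * b ^ ℓ < suc ℓ !)
factorial-dominates a b = ℓ , ≤-trans (s≤s z≤n) (m≤n+m t k) , (begin-strict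
  a * b ^ (k + t)        ≤⟨ *-monoˡ-≤ (b ^ (k + t)) (n≤1+n a) ⟩
  suc a * b ^ (k + t)        ≡⟨ cong (suc a *_) (^-distribˡ-+-* b k t) ⟩
  suc a * (b ^ k * b ^ t)    ≡⟨ *-assoc (suc a) (b ^ k) (b ^ t) ⟨
  suc a * b ^ k * b ^ t      ≤⟨ *-mono-≤ (<⇒≤ (<-trans (n<1+n (suc a * b ^ k)) (n<2^n t))) (^-monoˡ-≤ t (n≤1+n b)) ⟩
  2 ^ t * suc b ^ t          ≡⟨ ^-distribʳ-* 2 (suc b) t ⟨
  (2 * suc b) ^ t          ≤⟨ ^-≤-! k t ⟩
  (k + t) !              <⟨ m<m*n ((k + t) !) (suc (k + t)) {{(k + t) !≢0}} (s≤s (≤-trans (s≤s z≤n) (m≤n+m t k))) ⟩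
  (k + t) ! * suc (k + t)  ≡⟨ *-comm ((k + t) !) (suc (k + t)) ⟩
  suc (k + t) !            ∎)
  where
  open ≤-Reasoning
  k = ℕ.pred (2 * suc b)
  t = suc (suc a * b ^ k)
  ℓ = k + t

-- Positions on the line

infixl 6 _⊕_
opaque
  _⊕_ : ℤ → ℕ → ℤ
  p ⊕ k = p ℤ.+ ℤ.+ k

  ⊕-def : ∀ p k → p ℤ.+ ℤ.+ k ≡ p ⊕ k
  ⊕-def p k = refl

  ⊕-assoc : ∀ p a b → p ⊕ a ⊕ b ≡ p ⊕ (a + b)
  ⊕-assoc p a b = ℤ.+-assoc p (ℤ.+ a) (ℤ.+ b)

  ⊕-identityʳ : ∀ p → p ⊕ 0 ≡ p
  ⊕-identityʳ = ℤ.+-identityʳ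

  ⊕-cancelʳ : ∀ {p q} a → p ⊕ a ≡ q ⊕ a → p ≡ q
  ⊕-cancelʳ {p} {q} a = ∙-cancelʳ ℤ.+-0-abelianGroup (ℤ.+ a) p q

  ⊕-cancelˡ : ∀ p {a b} → p ⊕ a ≡ p ⊕ b → a ≡ b
  ⊕-cancelˡ p eq = ℤ.+-injective (∙-cancelˡ ℤ.+-0-abelianGroup p _ _ eq)

  ⊕-total : ∀ p q → ∃[ e ] (q ≡ p ⊕ e) ⊎ ∃[ e ] (p ≡ q ⊕ e)
  ⊕-total p q with q ℤ.- p in eq
  ... | ℤ.+ e      = inj₁ (e , trans (lem p q) (cong (ℤ._+_ p) eq))
    where
    lem : ∀ p q → q ≡ p ℤ.+ (q ℤ.- p)
    lem = solve-∀
  ... | ℤ.-[1+ e ] = inj₂ (suc e , trans (lem p q) (cong (λ d → q ℤ.- d) eq))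
    where
    lem : ∀ p q → p ≡ q ℤ.- (q ℤ.- p)
    lem = solve-∀

⊕-shift : ∀ {p q} a b k → p ⊕ a ≡ q ⊕ b → p ⊕ (k + a) ≡ q ⊕ (k + b)
⊕-shift {p} {q} a b k eq = begin
  p ⊕ (k + a)  ≡⟨ cong (p ⊕_) (+-comm k a) ⟩
  p ⊕ (a + k)  ≡⟨ ⊕-assoc p a k ⟨
  p ⊕ a ⊕ k    ≡⟨ cong (_⊕ k) eq ⟩
  q ⊕ b ⊕ k    ≡⟨ ⊕-assoc q b k ⟩
  q ⊕ (b + k)  ≡⟨ cong (q ⊕_) (+-comm b k) ⟩
  q ⊕ (k + b)  ∎
  where open ≡-Reasoning

⊕-unshift : ∀ {p q} a b k → p ⊕ (k + a) ≡ q ⊕ (k + b) → p ⊕ a ≡ q ⊕ b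
⊕-unshift {p} {q} a b k eq = ⊕-cancelʳ k (begin
  p ⊕ a ⊕ k    ≡⟨ ⊕-assoc p a k ⟩
  p ⊕ (a + k)  ≡⟨ cong (p ⊕_) (+-comm a k) ⟩
  p ⊕ (k + a)  ≡⟨ eq ⟩
  q ⊕ (k + b)  ≡⟨ cong (q ⊕_) (+-comm k b) ⟩
  q ⊕ (b + k)  ≡⟨ ⊕-assoc q b k ⟨
  q ⊕ b ⊕ k    ∎)
  where open ≡-Reasoning

⊕-≡⇒offset : ∀ {p q} a b e → q ≡ p ⊕ e → p ⊕ a ≡ q ⊕ b → a ≡ e + b
⊕-≡⇒offset {p} a b e refl eq = ⊕-cancelˡ p (trans eq (⊕-assoc p e b))

⊕-swap : ∀ p a b → p ⊕ a ⊕ b ≡ p ⊕ b ⊕ a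
⊕-swap p a b = trans (⊕-assoc p a b) (trans (cong (p ⊕_) (+-comm a b)) (sym (⊕-assoc p b a)))

infixl 6 _⊖_
opaque
  unfolding _⊕_

  _⊖_ : ℤ → ℕ → ℤ
  p ⊖ k = p ℤ.- ℤ.+ k

  ⊖-⊕ : ∀ p k → p ⊖ k ⊕ k ≡ p
  ⊖-⊕ p k = lem p (ℤ.+ k)
    where
    lem : ∀ p k → p ℤ.- k ℤ.+ k ≡ p
    lem = solve-∀

  ⊖-+-⊕ : ∀ i p k → i ⊖ k ℤ.+ p ⊕ k ≡ i ℤ.+ p
  ⊖-+-⊕ i p k = lem i p (ℤ.+ k)
    where
    lem : ∀ i p k → i ℤ.- k ℤ.+ p ℤ.+ k ≡ i ℤ.+ p
    lem = solve-∀

  ∣⊖∣≤ : ∀ p k → ℤ.∣ p ⊖ k ∣ ≤ ℤ.∣ p ∣ + k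
  ∣⊖∣≤ p k = ℤ.∣i-j∣≤∣i∣+∣j∣ p (ℤ.+ k)

  ∣⊕∣≤ : ∀ p k → ℤ.∣ p ⊕ k ∣ ≤ ℤ.∣ p ∣ + k
  ∣⊕∣≤ p k = ℤ.∣i+j∣≤∣i∣+∣j∣ p (ℤ.+ k)

⊕-⊖ : ∀ p k → p ⊕ k ⊖ k ≡ p
⊕-⊖ p k = ⊕-cancelʳ k (⊖-⊕ (p ⊕ k) k)

module Blocks (m : ℕ) {{_ : NonZero m}} where

  frame : ℤ → ℤ
  frame c = c ℤ./ℕ m

  offset : ℤ → ℕ
  offset c = c ℤ.%ℕ m

  offset< : ∀ c → offset c < m
  offset< c = ℤ.n%ℕd<d c m

  opaque
    unfolding _⊕_

    join : ℤ → ℕ → ℤ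
    join f k = f ℤ.* ℤ.+ m ⊕ k

    join-⊕ : ∀ f k l → join f k ⊕ l ≡ join f (k + l)
    join-⊕ f k l = ⊕-assoc (f ℤ.* ℤ.+ m) k l

    join-cancel : ∀ f {k k′} → join f k ≡ join f k′ → k ≡ k′
    join-cancel f = ⊕-cancelˡ (f ℤ.* ℤ.+ m)

    join-⊕ˡ : ∀ f e k → join (f ⊕ e) k ≡ join f (e * m + k)
    join-⊕ˡ f e k = begin
      (f ⊕ e) ℤ.* ℤ.+ m ⊕ k              ≡⟨ cong (_⊕ k) (ℤ.*-distribʳ-+ (ℤ.+ m) f (ℤ.+ e)) ⟩
      f ℤ.* ℤ.+ m ℤ.+ ℤ.+ e ℤ.* ℤ.+ m ⊕ k    ≡⟨ cong (λ em → f ℤ.* ℤ.+ m ℤ.+ em ⊕ k) (ℤ.pos-* e m) ⟨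
      f ℤ.* ℤ.+ m ⊕ e * m ⊕ k            ≡⟨ ⊕-assoc (f ℤ.* ℤ.+ m) (e * m) k ⟩
      f ℤ.* ℤ.+ m ⊕ (e * m + k)          ∎
      where open ≡-Reasoning

    join-split : ∀ c → c ≡ join (frame c) (offset c)
    join-split c = trans (ℤ.a≡a%ℕn+[a/ℕn]*n c m) (ℤ.+-comm (ℤ.+ offset c) (frame c ℤ.* ℤ.+ m))

    -- Rounding up: divide the negative of p. If - p = q * m + r, then p + r = (- q) * m.
    phase : ∀ p → ∃[ r ] ∃[ f ] (r < m × p ⊕ r ≡ join f 0)
    phase p = r , ℤ.- frame (ℤ.- p) , offset< (ℤ.- p) , (begin
      p ℤ.+ ℤ.+ r                                ≡⟨ lem₁ p (ℤ.+ r) ⟩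
      ℤ.- (ℤ.- p) ℤ.+ ℤ.+ r                      ≡⟨ cong (λ c → ℤ.- c ℤ.+ ℤ.+ r) (join-split (ℤ.- p)) ⟩
      ℤ.- (frame (ℤ.- p) ℤ.* ℤ.+ m ⊕ r) ℤ.+ ℤ.+ r  ≡⟨ lem₂ (frame (ℤ.- p)) (ℤ.+ m) (ℤ.+ r) ⟩
      ℤ.- frame (ℤ.- p) ℤ.* ℤ.+ m ⊕ 0            ∎)
      where
      open ≡-Reasoning
      r : ℕ
      r = offset (ℤ.- p)
      lem₁ : ∀ p r → p ℤ.+ r ≡ ℤ.- (ℤ.- p) ℤ.+ r
      lem₁ = solve-∀
      lem₂ : ∀ f m r → ℤ.- (f ℤ.* m ℤ.+ r) ℤ.+ r ≡ ℤ.- f ℤ.* m ℤ.+ 0ℤ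
      lem₂ = solve-∀

  ∣join∣≤ : ∀ f i l → ∣ join f i ∣ ≤ ∣ join f l ∣ + (i + l)
  ∣join∣≤ f i l = begin
    ∣ join f i ∣            ≡⟨ cong ∣_∣ (join-⊕ f 0 i) ⟨
    ∣ join f 0 ⊕ i ∣        ≡⟨ cong (λ c → ∣ c ⊕ i ∣) (⊕-⊖ (join f 0) l) ⟨
    ∣ join f 0 ⊕ l ⊖ l ⊕ i ∣  ≡⟨ cong (λ c → ∣ c ⊖ l ⊕ i ∣) (join-⊕ f 0 l) ⟩
    ∣ join f l ⊖ l ⊕ i ∣    ≤⟨ ∣⊕∣≤ (join f l ⊖ l) i ⟩
    ∣ join f l ⊖ l ∣ + i    ≤⟨ +-monoˡ-≤ i (∣⊖∣≤ (join f l) l) ⟩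
    ∣ join f l ∣ + l + i    ≡⟨ +-assoc ∣ join f l ∣ l i ⟩
    ∣ join f l ∣ + (l + i)  ≡⟨ cong (∣ join f l ∣ +_) (+-comm l i) ⟩
    ∣ join f l ∣ + (i + l)  ∎
    where open ≤-Reasoning

  join-suc : ∀ f k → join (f ⊕ 1) k ≡ join f (m + k)
  join-suc f k = trans (join-⊕ˡ f 1 k) (cong (λ l → join f (l + k)) (+-identityʳ m))

  join-next : ∀ f k → join (f ⊕ 1) k ≡ join f k ⊕ m
  join-next f k = trans (join-suc f k) (trans (cong (join f) (+-comm m k)) (sym (join-⊕ f k m)))

  private
    join-injective-⊕ : ∀ {f f′ k k′} e → f′ ≡ f ⊕ e → k < m → join f k ≡ join f′ k′ → f ≡ f′ × k ≡ k′
    join-injective-⊕ {f} {k = k} {k′} zero refl k< eq =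
      sym (⊕-identityʳ f) , join-cancel f (trans eq (join-⊕ˡ f 0 k′))
    join-injective-⊕ {f} {k = k} {k′} (suc e) refl k< eq = contradiction k< (≤⇒≯ (begin
      m                 ≤⟨ m≤m+n m (e * m) ⟩
      m + e * m         ≤⟨ m≤m+n (m + e * m) k′ ⟩
      m + e * m + k′    ≡⟨ join-cancel f (trans eq (join-⊕ˡ f (suc e) k′)) ⟨
      k                 ∎))
      where open ≤-Reasoning

  join-injective : ∀ {f f′ k k′} → k < m → k′ < m → join f k ≡ join f′ k′ → f ≡ f′ × k ≡ k′
  join-injective {f} {f′} k< k′< eq with ⊕-total f f′
  ... | inj₁ (e , f′≡) = join-injective-⊕ e f′≡ k< eq
  ... | inj₂ (e , f≡)  = let (p , q) = join-injective-⊕ e f≡ k′< (sym eq) in sym p , sym q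

  frame-join : ∀ {f k} → k < m → frame (join f k) ≡ f
  frame-join {f} {k} k< = proj₁ (join-injective {f′ = f} (offset< (join f k)) k< (sym (join-split (join f k))))

  offset-join : ∀ {f k} → k < m → offset (join f k) ≡ k
  offset-join {f} {k} k< = proj₂ (join-injective {f′ = f} (offset< (join f k)) k< (sym (join-split (join f k))))

-- Slots of four cells

opaque
  cell : ℕ → Fin 4 → ℕ
  cell g r = toℕ r + g * 4

  slotOf : ∀ k → ∃[ g ] ∃[ r ] (k ≡ cell g r)
  slotOf k = quotient , remainder , property
    where open ℕ.DivMod (k ℕ.divMod 4)

  cell-mono-< : ∀ {g g′} r r′ → g < g′ → cell g r < cell g′ r′
  cell-mono-< {g} {g′} r r′ g< = begin-strict
    toℕ r + g * 4    <⟨ +-monoˡ-< (g * 4) (Fin.toℕ<n r) ⟩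
    4 + g * 4        ≤⟨ *-monoˡ-≤ 4 g< ⟩
    g′ * 4           ≤⟨ m≤n+m (g′ * 4) (toℕ r′) ⟩
    toℕ r′ + g′ * 4  ∎
    where open ≤-Reasoning

  cell-cancel-< : ∀ {g g′} r → cell g r < cell g′ zero → g < g′
  cell-cancel-< {g} {g′} r c< with g ℕ.<? g′
  ... | yes g< = g<
  ... | no  g≮ = contradiction c< (≤⇒≯ (≤-trans (*-monoˡ-≤ 4 (≮⇒≥ g≮)) (m≤n+m (g * 4) (toℕ r))))

  cell-injective : ∀ {g g′ r r′} → cell g r ≡ cell g′ r′ → g ≡ g′ × r ≡ r′
  cell-injective {g} {g′} {r} {r′} eq with <-cmp g g′
  ... | tri< g< _ _ = contradiction eq (<⇒≢ (cell-mono-< r r′ g<))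
  ... | tri≈ _ refl _ = refl , Fin.toℕ-injective (+-cancelʳ-≡ (g * 4) _ _ eq)
  ... | tri> _ _ g> = contradiction (sym eq) (<⇒≢ (cell-mono-< r′ r g>))

  cell-zero : ∀ g → cell g zero ≡ g * 4
  cell-zero g = refl

  cell-suc : ∀ g → cell (suc g) zero ≡ suc (cell g 3F)
  cell-suc g = refl

  cell-toℕ : ∀ g r → cell g r ≡ toℕ r + cell g zero
  cell-toℕ g r = refl

  cell-+ : ∀ g g′ r → cell (g + g′) r ≡ cell g zero + cell g′ r
  cell-+ g g′ r = begin
    toℕ r + (g + g′) * 4       ≡⟨ cong (_+_ (toℕ r)) (*-distribʳ-+ 4 g g′) ⟩
    toℕ r + (g * 4 + g′ * 4)   ≡⟨ +-assoc (toℕ r) (g * 4) (g′ * 4) ⟨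
    toℕ r + g * 4 + g′ * 4     ≡⟨ cong (_+ g′ * 4) (+-comm (toℕ r) (g * 4)) ⟩
    g * 4 + toℕ r + g′ * 4     ≡⟨ +-assoc (g * 4) (toℕ r) (g′ * 4) ⟩
    g * 4 + (toℕ r + g′ * 4)   ∎
    where open ≡-Reasoning

-- The hypothesis is s - r = s′ - r′ written without subtraction: two coinciding cells still
-- coincide after both have moved by the same amount inside their slots.
slide : ∀ {p q g g′ r r′} s s′ → toℕ s + toℕ r′ ≡ toℕ s′ + toℕ r →
        p ⊕ cell g r ≡ q ⊕ cell g′ r′ → p ⊕ cell g s ≡ q ⊕ cell g′ s′
slide {p} {q} {g} {g′} {r} {r′} s s′ s+r′≡s′+r eq = ⊕-unshift (cell g s) (cell g′ s′) (toℕ r) (begin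
  p ⊕ (toℕ r + cell g s)                  ≡⟨ cong (p ⊕_) (exchange r s) ⟩
  p ⊕ (toℕ s + cell g r)                  ≡⟨ ⊕-shift (cell g r) (cell g′ r′) (toℕ s) eq ⟩
  q ⊕ (toℕ s + cell g′ r′)                ≡⟨ cong (λ k → q ⊕ (toℕ s + k)) (cell-toℕ g′ r′) ⟩
  q ⊕ (toℕ s + (toℕ r′ + cell g′ 0F))     ≡⟨ cong (q ⊕_) (+-assoc (toℕ s) (toℕ r′) (cell g′ 0F)) ⟨
  q ⊕ (toℕ s + toℕ r′ + cell g′ 0F)       ≡⟨ cong (λ x → q ⊕ (x + cell g′ 0F)) s+r′≡s′+r ⟩
  q ⊕ (toℕ s′ + toℕ r + cell g′ 0F)       ≡⟨ cong (λ x → q ⊕ (x + cell g′ 0F)) (+-comm (toℕ s′) (toℕ r)) ⟩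
  q ⊕ (toℕ r + toℕ s′ + cell g′ 0F)       ≡⟨ cong (q ⊕_) (+-assoc (toℕ r) (toℕ s′) (cell g′ 0F)) ⟩
  q ⊕ (toℕ r + (toℕ s′ + cell g′ 0F))     ≡⟨ cong (λ k → q ⊕ (toℕ r + k)) (cell-toℕ g′ s′) ⟨
  q ⊕ (toℕ r + cell g′ s′)                ∎)
  where
  open ≡-Reasoning
  exchange : ∀ r s → toℕ r + cell g s ≡ toℕ s + cell g r
  exchange r s = begin
    toℕ r + cell g s              ≡⟨ cong (toℕ r +_) (cell-toℕ g s) ⟩
    toℕ r + (toℕ s + cell g 0F)   ≡⟨ +-assoc (toℕ r) (toℕ s) (cell g 0F) ⟨
    toℕ r + toℕ s + cell g 0F     ≡⟨ cong (_+ cell g 0F) (+-comm (toℕ r) (toℕ s)) ⟩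
    toℕ s + toℕ r + cell g 0F     ≡⟨ +-assoc (toℕ s) (toℕ r) (cell g 0F) ⟩
    toℕ s + (toℕ r + cell g 0F)   ≡⟨ cong (toℕ s +_) (cell-toℕ g r) ⟨
    toℕ s + cell g r              ∎

⊕-cell : ∀ p g g′ r → p ⊕ cell g 0F ⊕ cell g′ r ≡ p ⊕ cell (g + g′) r
⊕-cell p g g′ r = trans (⊕-assoc p (cell g 0F) (cell g′ r)) (cong (p ⊕_) (sym (cell-+ g g′ r)))

-- The prototiles: masters and slaves

module Tiles (N W ℓ H : ℕ) (N≤W : N ≤ W) (0<ℓ : 0 < ℓ) (W+4ℓ<H : W + 4 * ℓ < H)
             (dig : Fin N → Fin N → Fin ℓ → ℕ) (dig≤ : ∀ u v i → dig u v i ≤ holes i) where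

  -- All lengths except m are measured in slots of four cells.  The slots of
  -- master u v i d are, in order: the solid head [0, H); the gap, of length
  -- suc (toℕ u); solid slots; the holes i left holes, beginning at L + toℕ d;
  -- solid slots; the holes i right holes, beginning at R; solid slots up to
  -- the end G of the frame; nothing up to G + H; and the tail, of length
  -- suc (toℕ v).  Of a hole the master only owns the cell 2.
  G L R m : ℕ
  G = H + H
  L = H + W
  R = L + 3 * ℓ
  m = cell G 0F

  data Kind : Set where
    master : (u v : Fin N) (i : Fin ℓ) → Fin (dig u v i) → Kind
    slave  : Fin (3 * ℓ) → Kind

  Master-finite : Finite (Σ[ u ∈ Fin N ] Σ[ v ∈ Fin N ] Σ[ i ∈ Fin ℓ ] Fin (dig u v i))
  Master-finite = Σ-finite (Fin-finite N) λ u → Σ-finite (Fin-finite N) λ v →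
                  Σ-finite (Fin-finite ℓ) λ i → Fin-finite (dig u v i)

  opaque
    Kind-finite : Finite Kind
    Kind-finite = ↔-finite
      (mk↔ₛ′ (λ { (inj₁ (u , v , i , d)) → master u v i d ; (inj₂ e) → slave e })
             (λ { (master u v i d) → inj₁ (u , v , i , d) ; (slave e) → inj₂ e })
             (λ { (master u v i d) → refl ; (slave e) → refl })
             (λ { (inj₁ (u , v , i , d)) → refl ; (inj₂ e) → refl }))
      (⊎-finite Master-finite (Fin-finite (3 * ℓ)))

  -- The zones 0, …, 8 are the parts of a master in the above order.
  owned : ℕ → Fin 4 → Bool
  owned 0 _  = true
  owned 2 _  = true
  owned 3 2F = true
  owned 4 _  = true
  owned 5 2F = true
  owned 6 _  = true
  owned 8 _  = true
  owned _ _  = false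

  -- Strictness leaves a solid slot at the end of the frame, which `masters-apart` uses through
  -- `last-cell`.
  R+ℓ<G : R + ℓ < G
  R+ℓ<G = begin-strict
    H + W + 3 * ℓ + ℓ      ≡⟨ cong (_+ ℓ) (+-assoc H W (3 * ℓ)) ⟩
    H + (W + 3 * ℓ) + ℓ    ≡⟨ +-assoc H (W + 3 * ℓ) ℓ ⟩
    H + (W + 3 * ℓ + ℓ)    ≡⟨ cong (H +_) (+-assoc W (3 * ℓ) ℓ) ⟩
    H + (W + (3 * ℓ + ℓ))  ≡⟨ cong (λ x → H + (W + x)) (+-comm (3 * ℓ) ℓ) ⟩
    H + (W + 4 * ℓ)        <⟨ +-monoʳ-< H W+4ℓ<H ⟩
    H + H                  ∎
    where open ≤-Reasoning

  toℕ<W : (u : Fin N) → toℕ u < W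
  toℕ<W u = <-≤-trans (Fin.toℕ<n u) N≤W

  module Master (u v : Fin N) (i : Fin ℓ) (d : Fin (dig u v i)) where

    pt : ℕ → ℕ
    pt 0 = 0
    pt 1 = H
    pt 2 = H + suc (toℕ u)
    pt 3 = L + toℕ d
    pt 4 = L + toℕ d + holes i
    pt 5 = R
    pt 6 = R + holes i
    pt 7 = G
    pt 8 = G + H
    pt _ = G + H + suc (toℕ v)

    d<ℓ : toℕ d < ℓ
    d<ℓ = <-≤-trans (Fin.toℕ<n d) (≤-trans (dig≤ u v i) (holes≤ i))

    pt≤pt-suc : ∀ z → pt z ≤ pt (suc z)
    pt≤pt-suc 0 = z≤n
    pt≤pt-suc 1 = m≤m+n H _
    pt≤pt-suc 2 = ≤-trans (+-monoʳ-≤ H (toℕ<W u)) (m≤m+n L (toℕ d))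
    pt≤pt-suc 3 = m≤m+n _ (holes i)
    pt≤pt-suc 4 = begin
      L + toℕ d + holes i    ≡⟨ +-assoc L (toℕ d) (holes i) ⟩
      L + (toℕ d + holes i)  ≤⟨ +-monoʳ-≤ L (+-mono-≤ (<⇒≤ d<ℓ) (≤-trans (holes≤ i) (m≤m+n ℓ _))) ⟩
      L + 3 * ℓ              ∎
      where open ≤-Reasoning
    pt≤pt-suc 5 = m≤m+n R _
    pt≤pt-suc 6 = <⇒≤ (≤-<-trans (+-monoʳ-≤ R (holes≤ i)) R+ℓ<G)
    pt≤pt-suc 7 = m≤m+n G H
    pt≤pt-suc 8 = m≤m+n (G + H) _
    pt≤pt-suc (suc (suc (suc (suc (suc (suc (suc (suc (suc _))))))))) = ≤-refl

    pt-mono : ∀ {y z} → y ≤ z → pt y ≤ pt z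
    pt-mono y≤z = go (≤⇒≤′ y≤z)
      where
      go : ∀ {y z} → y ℕ.≤′ z → pt y ≤ pt z
      go (ℕ.≤′-reflexive refl)   = ≤-refl
      go (ℕ.≤′-step {n = z} y≤z) = ≤-trans (go y≤z) (pt≤pt-suc z)

    record Zone (z g : ℕ) : Set where
      constructor between
      field
        pt≤ : pt z ≤ g
        <pt : g < pt (suc z)

    Zone? : ∀ z g → Dec (Zone z g)
    Zone? z g = map′ (λ (p , q) → between p q) (λ Z → Zone.pt≤ Z , Zone.<pt Z)
                     (pt z ℕ.≤? g ×-dec g ℕ.<? pt (suc z))

    zone-unique : ∀ {y z g} → Zone y g → Zone z g → y ≡ z
    zone-unique {y} {z} (between y≤ <y) (between z≤ <z) with <-cmp y z
    ... | tri< y<z _ _ = contradiction (<-≤-trans <y (pt-mono y<z)) (≤⇒≯ z≤)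
    ... | tri≈ _ y≡z _ = y≡z
    ... | tri> _ _ z<y = contradiction (<-≤-trans <z (pt-mono z<y)) (≤⇒≯ y≤)

    zone : ∀ b g → g < pt b → ∃[ z ] (z < b × Zone z g)
    zone (suc b) g g< with g ℕ.<? pt b
    ... | no  g≮ = b , ≤-refl , between (≮⇒≥ g≮) g<
    ... | yes g<′ with zone b g g<′
    ...   | z , z<b , Z = z , m<n⇒m<1+n z<b , Z

    Cell : ℕ → Fin 4 → Set
    Cell g r = ∃[ z ] (z < 9 × Zone z g × T (owned z r))

    Cell? : ∀ g r → Dec (Cell g r)
    Cell? g r = anyUpTo? (λ z → Zone? z g ×-dec T? (owned z r)) 9

    Hole : ℕ → Set
    Hole g = Zone 3 g ⊎ Zone 5 g

    zone⇒owned : ∀ {z g r} → Zone z g → Cell g r → T (owned z r)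
    zone⇒owned Z (y , _ , Y , t) with zone-unique Z Y
    ... | refl = t

    hole-cell : ∀ {g r} → Hole g → Cell g r → r ≡ 2F
    hole-cell {r = r} (inj₁ Z) c with r | zone⇒owned Z c
    ... | 2F | _ = refl
    hole-cell {r = r} (inj₂ Z) c with r | zone⇒owned Z c
    ... | 2F | _ = refl

    gap-cell : ∀ {j r} → j < suc (toℕ u) → ¬ Cell (H + j) r
    gap-cell j< c = zone⇒owned {1} (between (m≤m+n H _) (+-monoʳ-< H j<)) c

    head-cell : ∀ {g r} → g < H → Cell g r
    head-cell g< = 0 , <ᵇ⇒< 0 9 _ , between z≤n g< , _

    mid-cell : ∀ {g r} → H + suc (toℕ u) ≤ g → g < L + toℕ d → Cell g r
    mid-cell ≤g g< = 2 , <ᵇ⇒< 2 9 _ , between ≤g g< , _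

    end-cell : ∀ {g r} → R + holes i ≤ g → g < G → Cell g r
    end-cell ≤g g< = 6 , <ᵇ⇒< 6 9 _ , between ≤g g< , _

    tail-cell : ∀ {j r} → j < suc (toℕ v) → Cell (G + H + j) r
    tail-cell j< = 8 , ≤-refl , between (m≤m+n (G + H) _) (+-monoʳ-< (G + H) j<) , _

    cell-slot : ∀ {g r} → Cell g r → g < G ⊎ ∃[ j ] (j < suc (toℕ v) × g ≡ G + H + j)
    cell-slot (z , z<9 , between ≤g g< , t) with m<1+n⇒m<n∨m≡n z<9
    ... | inj₂ refl with m≤n⇒∃[o]m+o≡n ≤g
    ...   | j , refl = inj₂ (j , +-cancelˡ-< (G + H) j _ g< , refl)
    cell-slot (z , z<9 , between ≤g g< , t) | inj₁ z<8 with m<1+n⇒m<n∨m≡n z<8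
    ... | inj₂ refl = ⊥-elim t
    ... | inj₁ z<7  = inj₁ (<-≤-trans g< (pt-mono z<7))

    cell-full-or-hole : ∀ {g r} → Cell g r → (∀ r′ → Cell g r′) ⊎ (Hole g × r ≡ 2F)
    cell-full-or-hole (0 , z<9 , Z , t) = inj₁ λ _ → 0 , z<9 , Z , _
    cell-full-or-hole (2 , z<9 , Z , t) = inj₁ λ _ → 2 , z<9 , Z , _
    cell-full-or-hole {r = 2F} (3 , z<9 , Z , t) = inj₂ (inj₁ Z , refl)
    cell-full-or-hole (4 , z<9 , Z , t) = inj₁ λ _ → 4 , z<9 , Z , _
    cell-full-or-hole {r = 2F} (5 , z<9 , Z , t) = inj₂ (inj₂ Z , refl)
    cell-full-or-hole (6 , z<9 , Z , t) = inj₁ λ _ → 6 , z<9 , Z , _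
    cell-full-or-hole (8 , z<9 , Z , t) = inj₁ λ _ → 8 , z<9 , Z , _

  -- A left hole is at L + d + a with d, a < ℓ, a right hole at L + 3 * ℓ + b with b < ℓ, so their
  -- distance is in [ℓ, 4 * ℓ). The lower bound keeps the two pieces of a slave off the same side,
  -- the upper bound, being below H, keeps them in the same frame.
  δ : Fin (3 * ℓ) → ℕ
  δ e = ℓ + toℕ e

  Cell : Kind → ℕ → Fin 4 → Set
  Cell (master u v i d) g r = Master.Cell u v i d g r
  Cell (slave e)        g r = (g ≡ 0 ⊎ g ≡ δ e) × r ≢ 2F

  Cell? : ∀ k g r → Dec (Cell k g r)
  Cell? (master u v i d) g r = Master.Cell? u v i d g r
  Cell? (slave e)        g r = (g ℕ.≟ 0 ⊎-dec g ℕ.≟ δ e) ×-dec ¬? (r Fin.≟ 2F)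

  H≤L : H ≤ L
  H≤L = m≤m+n H W

  L≤R : L ≤ R
  L≤R = m≤m+n L _

  0<H : 0 < H
  0<H = ≤-<-trans z≤n W+4ℓ<H

  δ<H : ∀ e → δ e < H
  δ<H e = <-trans (<-≤-trans (+-monoʳ-< ℓ (Fin.toℕ<n e)) (m≤n+m (4 * ℓ) W)) W+4ℓ<H

  -- Besides making a prototile a finite list, this tells `next` that no master reaches a cell two
  -- frame lengths after its start.
  cell-bound : ∀ k {g r} → Cell k g r → g < G + G
  cell-bound (master u v i d) c with Master.cell-slot u v i d c
  ... | inj₁ g<            = <-≤-trans g< (m≤m+n G G)
  ... | inj₂ (j , j< , refl) = begin-strict
    G + H + j      <⟨ +-monoʳ-< (G + H) (<-≤-trans j< (≤-trans (toℕ<W v) W≤H)) ⟩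
    G + H + H      ≡⟨ +-assoc G H H ⟩
    G + G          ∎
    where
    open ≤-Reasoning
    W≤H : W ≤ H
    W≤H = <⇒≤ (≤-<-trans (m≤m+n W _) W+4ℓ<H)
  cell-bound (slave e) (inj₁ refl , _) = <-≤-trans 0<H (≤-trans (m≤m+n H H) (m≤m+n G G))
  cell-bound (slave e) (inj₂ refl , _) = <-≤-trans (δ<H e) (≤-trans (m≤m+n H H) (m≤m+n G G))

  cells : Kind → List (ℕ × Fin 4)
  cells k = filter (λ (g , r) → Cell? k g r) (cartesianProduct (upTo (G + G)) (allFin 4))

  ∈-cells⁺ : ∀ k {g r} → Cell k g r → (ℤ.+ cell g r) ∈ map (λ (g , r) → ℤ.+ cell g r) (cells k)
  ∈-cells⁺ k c = ∈-map⁺ _ (∈-filter⁺ (λ (g , r) → Cell? k g r)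
    (∈-cartesianProduct⁺ (∈-upTo⁺ (cell-bound k c)) (∈-allFin _)) c)

  ∈-cells⁻ : ∀ k {p} → p ∈ map (λ (g , r) → ℤ.+ cell g r) (cells k) →
             ∃[ g ] ∃[ r ] (Cell k g r × p ≡ ℤ.+ cell g r)
  ∈-cells⁻ k p∈ with ∈-map⁻ _ p∈
  ... | (g , r) , gr∈ , eq =
    g , r , proj₂ (∈-filter⁻ (λ (g , r) → Cell? k g r) {xs = cartesianProduct (upTo (G + G)) (allFin 4)} gr∈) , eq

  origin : ∀ k → Cell k 0 0F
  origin (master u v i d) = Master.head-cell u v i d 0<H
  origin (slave e)        = inj₁ refl , λ ()

  opaque
    protoOf : Kind → Prototile
    protoOf k = record
      { elements = map (λ (g , r) → ℤ.+ cell g r) (cells k)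
      ; 0∈ = subst (λ c → (ℤ.+ c) ∈ map (λ (g , r) → ℤ.+ cell g r) (cells k)) (cell-zero 0) (∈-cells⁺ k (origin k))
      ; 0≤ = All.tabulate nonneg }
      where
      nonneg : ∀ {p} → p ∈ map (λ (g , r) → ℤ.+ cell g r) (cells k) → 0ℤ ℤ.≤ p
      nonneg p∈ with ∈-cells⁻ k p∈
      ... | g , r , _ , refl = ℤ.+≤+ z≤n

    ∈-protoOf⁺ : ∀ k {g r} → Cell k g r → (ℤ.+ cell g r) ∈ elements (protoOf k)
    ∈-protoOf⁺ = ∈-cells⁺

    ∈-protoOf⁻ : ∀ k {p} → p ∈ elements (protoOf k) → ∃[ g ] ∃[ r ] (Cell k g r × p ≡ ℤ.+ cell g r)
    ∈-protoOf⁻ = ∈-cells⁻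

  infix 4 _⊑_
  _⊑_ : Kind → Kind → Set
  k ⊑ k′ = ∀ {g r} → Cell k g r → Cell k′ g r

  ≋⇒⊑ : ∀ {k k′} → protoOf k ≋ protoOf k′ → k ⊑ k′
  ≋⇒⊑ {k} {k′} eq {g} {r} c with ∈-protoOf⁻ k′ (Equivalence.to (eq _) (∈-protoOf⁺ k c))
  ... | g′ , r′ , c′ , eq′ with cell-injective {g} {g′} (ℤ.+-injective eq′)
  ...   | refl , refl = c′

  ≋-sym : ∀ {P Q} → P ≋ Q → Q ≋ P
  ≋-sym eq i = ⇔-sym (eq i)

  module _ {u v i d u′ v′ i′ d′} (⊑ : master u v i d ⊑ master u′ v′ i′ d′) where
    private
      module M  = Master u v i d
      module M′ = Master u′ v′ i′ d′

      0F≢2F : _≢_ {A = Fin 4} 0F 2F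
      0F≢2F ()

    -- A longer gap in the larger tile would contain the solid slot that follows the shorter gap of
    -- the smaller tile.
    ⊑⇒u : toℕ u′ ≤ toℕ u
    ⊑⇒u = ≮⇒≥ λ u<u′ → M′.gap-cell {r = 0F} (s≤s u<u′)
      (⊑ (M.mid-cell ≤-refl (<-≤-trans (+-monoʳ-< H (≤-<-trans u<u′ (toℕ<W u′))) (m≤m+n L _))))

    ⊑⇒v : toℕ v ≤ toℕ v′
    ⊑⇒v with M′.cell-slot (⊑ {r = 0F} (M.tail-cell ≤-refl))
    ... | inj₁ g<            = contradiction g< (≤⇒≯ (≤-trans (m≤m+n G H) (m≤m+n (G + H) _)))
    ... | inj₂ (j , j< , eq) with +-cancelˡ-≡ (G + H) (toℕ v) j eq
    ...   | refl = ℕ.s≤s⁻¹ j<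

    -- Otherwise the first left hole of the larger tile would be a solid slot of the smaller one;
    -- `0<holes` guarantees that there is such a hole.
    ⊑⇒d : toℕ d ≤ toℕ d′
    ⊑⇒d = ≮⇒≥ λ d′<d → 0F≢2F (M′.hole-cell (inj₁ (M′.between ≤-refl (m<m+n _ (0<holes i′))))
      (⊑ {r = 0F} (M.mid-cell (≤-trans (+-monoʳ-≤ H (toℕ<W u)) (m≤m+n L _)) (+-monoʳ-< L d′<d))))

    ⊑⇒i : holes i′ ≤ holes i
    ⊑⇒i = ≮⇒≥ λ i<i′ → 0F≢2F (M′.hole-cell (inj₂ (M′.between (m≤m+n R _) (+-monoʳ-< R i<i′)))
      (⊑ {r = 0F} (M.end-cell ≤-refl (≤-<-trans (+-monoʳ-≤ R (holes≤ i)) R+ℓ<G))))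

  ⊑-antisym : ∀ {k k′} → k ⊑ k′ → k′ ⊑ k → k ≡ k′
  ⊑-antisym {master u v i d} {master u′ v′ i′ d′} p q
    with Fin.toℕ-injective {i = u} {u′} (≤-antisym (⊑⇒u q) (⊑⇒u p))
       | Fin.toℕ-injective {i = v} {v′} (≤-antisym (⊑⇒v p) (⊑⇒v q))
       | holes-injective {i = i} {i′} (≤-antisym (⊑⇒i q) (⊑⇒i p))
  ... | refl | refl | refl with Fin.toℕ-injective {i = d} {d′} (≤-antisym (⊑⇒d p) (⊑⇒d q))
  ...   | refl = refl
  -- A master owns cell 2 of its first slot, a slave owns no cell 2 at all.
  ⊑-antisym {master u v i d} {slave e} p q = contradiction refl (proj₂ (p {r = 2F} (Master.head-cell u v i d 0<H)))
  ⊑-antisym {slave e} {master u v i d} p q = contradiction refl (proj₂ (q {r = 2F} (Master.head-cell u v i d 0<H)))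
  ⊑-antisym {slave e} {slave e′} p q with proj₁ (p {r = 0F} (inj₂ refl , λ ()))
  ... | inj₁ eq = contradiction (≤-trans 0<ℓ (m≤m+n ℓ (toℕ e))) (≤⇒≯ (≤-reflexive eq))
  ... | inj₂ eq = cong slave (Fin.toℕ-injective (+-cancelˡ-≡ ℓ (toℕ e) (toℕ e′) eq))

  𝒫 : Collection
  𝒫 = record
    { size      = card Kind-finite
    ; nonempty  = Fin.nonZeroIndex (index Kind-finite (slave (fromℕ< (≤-trans 0<ℓ (m≤m+n ℓ _)))))
    ; prototile = protoOf ∘ element Kind-finite
    ; distinct  = λ {k} {k′} eq → element-injective Kind-finite
        (⊑-antisym (≋⇒⊑ eq) (≋⇒⊑ (≋-sym {protoOf (element Kind-finite k)} {protoOf (element Kind-finite k′)} eq)))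
    }

  -- A frame together with its filling is one numeral of the factorial system: `level` and `digit`
  -- select the master, and `code` pairs its left holes with its right holes.
  record Frame : Set where
    constructor mkFrame
    field
      {inState outState} : Fin N
      level : Fin ℓ
      digit : Fin (dig inState outState level)
      code  : Code (holes level)

    kind : Kind
    kind = master inState outState level digit

    leftHole rightHole : Fin (holes level) → ℕ
    leftHole a = L + toℕ digit + toℕ a
    rightHole b = R + toℕ b

    opaque
      connect : ∀ a b → ∃[ e ] (leftHole a + δ e ≡ rightHole b)
      connect a b with m≤n⇒∃[o]m+o≡n {toℕ digit + toℕ a + ℓ} {3 * ℓ + toℕ b}
                        (≤-trans (+-mono-≤ (+-mono-≤ (<⇒≤ (Master.d<ℓ _ _ _ digit)) (<⇒≤ (a<ℓ a))) (≤-reflexive (sym (+-identityʳ ℓ))))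
                                 (≤-trans (≤-reflexive (+-assoc ℓ ℓ (ℓ + 0))) (m≤m+n (3 * ℓ) (toℕ b))))
        where
        a<ℓ : ∀ (a : Fin (holes level)) → toℕ a < ℓ
        a<ℓ a = <-≤-trans (Fin.toℕ<n a) (holes≤ level)
      ... | o , eq = fromℕ< o<3ℓ , (begin
        L + toℕ digit + toℕ a + (ℓ + toℕ (fromℕ< o<3ℓ))  ≡⟨ cong (λ o → L + toℕ digit + toℕ a + (ℓ + o)) (Fin.toℕ-fromℕ< o<3ℓ) ⟩
        L + toℕ digit + toℕ a + (ℓ + o)                  ≡⟨ cong (_+ (ℓ + o)) (+-assoc L (toℕ digit) (toℕ a)) ⟩
        L + (toℕ digit + toℕ a) + (ℓ + o)                ≡⟨ +-assoc L (toℕ digit + toℕ a) (ℓ + o) ⟩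
        L + (toℕ digit + toℕ a + (ℓ + o))                ≡⟨ cong (L +_) (+-assoc (toℕ digit + toℕ a) ℓ o) ⟨
        L + (toℕ digit + toℕ a + ℓ + o)                  ≡⟨ cong (L +_) eq ⟩
        L + (3 * ℓ + toℕ b)                              ≡⟨ +-assoc L (3 * ℓ) (toℕ b) ⟨
        R + toℕ b                                        ∎)
        where
        open ≡-Reasoning
        o<3ℓ : o < 3 * ℓ
        o<3ℓ = +-cancelˡ-< ℓ o (3 * ℓ) (≤-<-trans (≤-trans (+-monoˡ-≤ o (m≤n+m ℓ (toℕ digit + toℕ a))) (≤-reflexive eq))
                 (<-≤-trans (+-monoʳ-< (3 * ℓ) (<-≤-trans (Fin.toℕ<n b) (holes≤ level))) (≤-reflexive (+-comm (3 * ℓ) ℓ))))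

    link : Fin (holes level) → Fin (3 * ℓ)
    link a = proj₁ (connect a (decode code a))

    leftHole-link : ∀ a → leftHole a + δ (link a) ≡ rightHole (decode code a)
    leftHole-link a = proj₂ (connect a (decode code a))

  δ-injective : ∀ {e e′} → δ e ≡ δ e′ → e ≡ e′
  δ-injective {e} {e′} eq = Fin.toℕ-injective (+-cancelˡ-≡ ℓ (toℕ e) (toℕ e′) eq)

  W<H : W < H
  W<H = ≤-<-trans (m≤m+n W _) W+4ℓ<H

  IsMaster : Kind → Set
  IsMaster (master _ _ _ _) = ⊤
  IsMaster (slave _)        = ⊥

  master⊎slave : ∀ k → IsMaster k ⊎ ∃[ e ] k ≡ slave e
  master⊎slave (master _ _ _ _) = inj₁ tt
  master⊎slave (slave e)        = inj₂ (e , refl)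

  -- These are total on kinds, and empty for slaves, so that they apply to the kind of an arbitrary
  -- tile of a tiling.
  Left Right Hole : Kind → ℕ → Set
  Left (master u v i d) = Master.Zone u v i d 3
  Left (slave _)        g = ⊥
  Right (master u v i d) = Master.Zone u v i d 5
  Right (slave _)        g = ⊥
  Hole k g = Left k g ⊎ Right k g

  Left⇒¬Right : ∀ k {g} → Left k g → ¬ Right k g
  Left⇒¬Right (master u v i d) l r with Master.zone-unique u v i d l r
  ... | ()

  -- A side consists of at most ℓ consecutive holes and δ e is at least ℓ, so the two holes are on
  -- different sides; the one further left is then a left hole.
  linked-holes : ∀ k {e g} → Hole k g → Hole k (g + δ e) → Left k g × Right k (g + δ e)
  linked-holes (slave _) (inj₁ ())
  linked-holes (slave _) (inj₂ ())
  linked-holes (master u v i d) {e} {g} h h′ = go h h′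
    where
    open Master u v i d
    same-side : ∀ {b} → b ≤ g → g + δ e < b + holes i → ⊥
    same-side {b} b≤ <b+i = <⇒≱ <b+i (+-mono-≤ b≤ (≤-trans (holes≤ i) (m≤m+n ℓ (toℕ e))))
    go : Zone 3 g ⊎ Zone 5 g → Zone 3 (g + δ e) ⊎ Zone 5 (g + δ e) → Zone 3 g × Zone 5 (g + δ e)
    go (inj₁ l) (inj₂ r)  = l , r
    go (inj₁ l) (inj₁ l′) = ⊥-elim (same-side (Zone.pt≤ l) (Zone.<pt l′))
    go (inj₂ r) (inj₂ r′) = ⊥-elim (same-side (Zone.pt≤ r) (Zone.<pt r′))
    go (inj₂ r) (inj₁ l′) = contradiction (<-≤-trans (Zone.<pt l′) (≤-trans (pt≤pt-suc 4) (Zone.pt≤ r))) (≤⇒≯ (m≤m+n g _))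

  gap tail : Kind → ℕ
  gap (master u v i d) = suc (toℕ u)
  gap (slave _)        = 0
  tail (master u v i d) = suc (toℕ v)
  tail (slave _)        = 0

  tail≤W : ∀ k → tail k ≤ W
  tail≤W (master u v i d) = toℕ<W v
  tail≤W (slave _)        = z≤n

  gap≤W : ∀ k → gap k ≤ W
  gap≤W (master u v i d) = toℕ<W u
  gap≤W (slave _)        = z≤n

  0<gap : ∀ k → IsMaster k → 0 < gap k
  0<gap (master _ _ _ _) _ = s≤s z≤n

  hole-bounds : ∀ k {g} → Hole k g → L ≤ g × g < G
  hole-bounds (master u v i d) (inj₁ Z) =
    ≤-trans (m≤m+n L _) (Master.Zone.pt≤ Z) ,
    <-≤-trans (Master.Zone.<pt Z) (Master.pt-mono u v i d {4} {7} (≤ᵇ⇒≤ 4 7 _))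
  hole-bounds (master u v i d) (inj₂ Z) =
    ≤-trans L≤R (Master.Zone.pt≤ Z) , <-≤-trans (Master.Zone.<pt Z) (Master.pt≤pt-suc u v i d 6)

  hole-cell : ∀ k {g r} → Hole k g → Cell k g r → r ≡ 2F
  hole-cell (master u v i d) h = Master.hole-cell u v i d h
  hole-cell (slave _) (inj₁ ())
  hole-cell (slave _) (inj₂ ())

  head-cell : ∀ k {g r} → IsMaster k → g < H → Cell k g r
  head-cell (master u v i d) _ = Master.head-cell u v i d

  last-cell : ∀ k {g r} → IsMaster k → suc g ≡ G → Cell k g r
  last-cell (master u v i d) _ eq = Master.end-cell u v i d
    (≤-trans (+-monoʳ-≤ R (holes≤ i)) (ℕ.s≤s⁻¹ (≤-trans R+ℓ<G (≤-reflexive (sym eq))))) (≤-reflexive eq)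

  gap-cell : ∀ k {y r} → y < gap k → ¬ Cell k (H + y) r
  gap-cell (master u v i d) = Master.gap-cell u v i d

  beyond-gap-cell : ∀ k {y r} → IsMaster k → gap k ≤ y → y < W → Cell k (H + y) r
  beyond-gap-cell (master u v i d) _ ≤y y< =
    Master.mid-cell u v i d (+-monoʳ-≤ H ≤y) (<-≤-trans (+-monoʳ-< H y<) (m≤m+n L _))

  tail-cell : ∀ k {y r} → y < tail k → Cell k (G + H + y) r
  tail-cell (master u v i d) = Master.tail-cell u v i d

  cell-slot : ∀ k {g r} → IsMaster k → Cell k g r → g < G ⊎ ∃[ y ] (y < tail k × g ≡ G + H + y)
  cell-slot (master u v i d) _ = Master.cell-slot u v i d

  -- The empty slots between the frame and the tail leave the first cell after the frame to another
  -- tile, which `next` shows to be a master starting there.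
  end-free : ∀ k {g r} → IsMaster k → Cell k g r → m ≢ cell g r
  end-free k {g} M c m≡ with cell-injective {G} {g} m≡
  ... | refl , refl with cell-slot k M c
  ...   | inj₁ G<G          = contradiction G<G (n≮n G)
  ...   | inj₂ (y , _ , G≡) = contradiction (<-≤-trans (m<m+n G 0<H) (m≤m+n (G + H) y)) (≤⇒≯ (≤-reflexive (sym G≡)))

  cell-full-or-hole : ∀ k {g r} → IsMaster k → Cell k g r → (∀ r′ → Cell k g r′) ⊎ (Hole k g × r ≡ 2F)
  cell-full-or-hole (master u v i d) _ = Master.cell-full-or-hole u v i d

  Piece : Kind → ℕ → Set
  Piece (master _ _ _ _) g = ⊥
  Piece (slave e)        g = g ≡ 0 ⊎ g ≡ δ e

  piece-cell : ∀ k {g r} → Piece k g → r ≢ 2F → Cell k g r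
  piece-cell (slave e) = _,_

  cell-piece : ∀ {k e g r} → k ≡ slave e → Cell k g r → Piece k g × r ≢ 2F
  cell-piece refl c = c

  piece≢master : ∀ k {g} → Piece k g → ¬ IsMaster k
  piece≢master (slave e) _ ()

  0<m : 0 < m
  0<m = ≤-<-trans z≤n (cell-mono-< {0} {G} 0F 0F (<-≤-trans 0<H (m≤m+n H H)))

  instance
    m≢0 : NonZero m
    m≢0 = ℕ.>-nonZero 0<m

  open Blocks m

  -- Every tiling splits into frames

  module _ (τ : Tiling 𝒫) where
    open Tiling τ renaming (position to pos)

    K : Index → Kind
    K j = element Kind-finite (kind j)

    cell∈ : ∀ {j} g r → Cell (K j) g r → tileAt j (pos j ⊕ cell g r)
    cell∈ {j} g r c = ℤ.+ cell g r , ∈-protoOf⁺ (K j) c , sym (⊕-def (pos j) (cell g r))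

    covered : ∀ i → ∃[ j ] ∃[ g ] ∃[ r ] (Cell (K j) g r × i ≡ pos j ⊕ cell g r)
    covered i with covers i
    ... | j , p , p∈ , i≡ with ∈-protoOf⁻ (K j) p∈
    ...   | g , r , c , refl = j , g , r , c , trans i≡ (⊕-def (pos j) (cell g r))

    clash : ∀ {j j′ g g′ r r′} → Cell (K j) g r → Cell (K j′) g′ r′ →
            pos j ⊕ cell g r ≡ pos j′ ⊕ cell g′ r′ → j ≡ j′
    clash {j} {j′} {g} {g′} {r} {r′} c c′ eq =
      disjoint (cell∈ g r c) (subst (tileAt j′) (sym eq) (cell∈ g′ r′ c′))

    -- The middle cell of a piece {0, 1, 3} cannot lie in another piece, so it
    -- is an isolated cell of a master.
    piece-hole : ∀ {j g} → Piece (K j) g →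
                 ∃[ j′ ] ∃[ g′ ] (IsMaster (K j′) × Hole (K j′) g′ × pos j ⊕ cell g 0F ≡ pos j′ ⊕ cell g′ 0F)
    piece-hole {j} {g} P with covered (pos j ⊕ cell g 2F)
    ... | j′ , g′ , r′ , c′ , eq with master⊎slave (K j′)
    ...   | inj₂ (e , K≡) = contradiction (sym (proj₂ same-cell)) (proj₂ (cell-piece K≡ c′))
      where
      Kj : ∀ {r} → r ≢ 2F → Cell (K j) g r
      Kj = piece-cell (K j) P
      Kj′ : ∀ {r} → r ≢ 2F → Cell (K j′) g′ r
      Kj′ = piece-cell (K j′) (proj₁ (cell-piece K≡ c′))
      same-tile : ∀ r′ → r′ ≢ 2F → pos j ⊕ cell g 2F ≡ pos j′ ⊕ cell g′ r′ → j ≡ j′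
      same-tile 0F _ eq = clash (Kj {3F} λ ()) (Kj′ {1F} λ ()) (slide {r = 2F} {0F} 3F 1F refl eq)
      same-tile 1F _ eq = clash (Kj {1F} λ ()) (Kj′ {0F} λ ()) (slide {r = 2F} {1F} 1F 0F refl eq)
      same-tile 2F ≢2F _ = contradiction refl ≢2F
      same-tile 3F _ eq = clash (Kj {0F} λ ()) (Kj′ {1F} λ ()) (slide {r = 2F} {3F} 0F 1F refl eq)
      same-cell : g ≡ g′ × 2F ≡ r′
      same-cell with same-tile r′ (proj₂ (cell-piece K≡ c′)) eq
      ... | refl = cell-injective {g} {g′} (⊕-cancelˡ (pos j) eq)
    ...   | inj₁ M with cell-full-or-hole (K j′) M c′
    ...     | inj₂ (h , refl) = j′ , g′ , M , h , slide {r = 2F} {2F} 0F 0F refl eq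
    ...     | inj₁ full = contradiction (subst (IsMaster ∘ K) (sym (same-tile r′ eq)) M) (piece≢master (K j) P)
      where
      Kj : ∀ {r} → r ≢ 2F → Cell (K j) g r
      Kj = piece-cell (K j) P
      same-tile : ∀ r′ → pos j ⊕ cell g 2F ≡ pos j′ ⊕ cell g′ r′ → j ≡ j′
      same-tile 0F eq = clash (Kj {3F} λ ()) (full 1F) (slide {r = 2F} {0F} 3F 1F refl eq)
      same-tile 1F eq = clash (Kj {1F} λ ()) (full 0F) (slide {r = 2F} {1F} 1F 0F refl eq)
      same-tile 2F eq = clash (Kj {3F} λ ()) (full 3F) (slide {r = 2F} {2F} 3F 3F refl eq)
      same-tile 3F eq = clash (Kj {1F} λ ()) (full 2F) (slide {r = 2F} {3F} 1F 2F refl eq)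

    -- The head of the later master would meet the head or the last cell of
    -- the earlier one.
    masters-apart : ∀ {j j′} e → IsMaster (K j) → IsMaster (K j′) → pos j′ ≡ pos j ⊕ e → j ≡ j′ ⊎ m ≤ e
    masters-apart {j} {j′} e M M′ pos≡ with e ℕ.<? cell H 0F
    ... | yes e< with slotOf e
    ...   | g , r , refl = inj₁ (clash (head-cell (K j) {g} {r} M (cell-cancel-< {g} r e<)) (head-cell (K j′) {0} {0F} M′ 0<H)
                                       (sym (trans (cong (pos j′ ⊕_) (cell-zero 0)) (trans (⊕-identityʳ (pos j′)) pos≡))))
    masters-apart {j} {j′} e M M′ pos≡ | no e≮ with m ℕ.≤? e
    ... | yes m≤e = inj₂ m≤e
    ... | no  m≰e with m≤n⇒∃[o]m+o≡n (≰⇒> m≰e) | m≤n⇒∃[o]m+o≡n (<-≤-trans 0<H (m≤m+n H H))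
    ...   | o , e+o≡ | G′ , G≡ with slotOf o
    ...     | g , r , refl = inj₁ (clash (last-cell (K j) {G′} {3F} M G≡) (head-cell (K j′) {g} {r} M′ (cell-cancel-< {g} r o<))
                (trans (cong (pos j ⊕_) last≡) (trans (sym (⊕-assoc (pos j) e o)) (cong (_⊕ o) (sym pos≡)))))
      where
      o< : cell g r < cell H 0F
      o< = +-cancelˡ-< (cell H 0F) o (cell H 0F) (begin-strict
        cell H 0F + o          <⟨ s≤s (+-monoˡ-≤ o (≮⇒≥ e≮)) ⟩
        suc e + o              ≡⟨ e+o≡ ⟩
        cell (H + H) 0F        ≡⟨ cell-+ H H 0F ⟩
        cell H 0F + cell H 0F  ∎)
        where open ≤-Reasoning
      last≡ : cell G′ 3F ≡ e + o
      last≡ = suc-injective (trans (sym (cell-suc G′)) (trans (cong (λ g → cell g 0F) G≡) (sym e+o≡)))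

    -- Frames have length m and by `masters-apart` their starts are at least m apart. The cells
    -- compared here are mere positions and need not be owned by the masters.
    frame-unique : ∀ {j j′ g g′ r r′} → IsMaster (K j) → IsMaster (K j′) → g < G → g′ < G →
                   pos j ⊕ cell g r ≡ pos j′ ⊕ cell g′ r′ → j ≡ j′ × g ≡ g′ × r ≡ r′
    frame-unique {j} {j′} {g} {g′} {r} {r′} M M′ g< g′< eq = same-tile , same-cell same-tile
      where
      apart : ∀ {j j′ g g′ r r′} e → IsMaster (K j) → IsMaster (K j′) → g < G →
              pos j′ ≡ pos j ⊕ e → pos j ⊕ cell g r ≡ pos j′ ⊕ cell g′ r′ → j ≡ j′
      apart {g = g} {g′} {r} {r′} e M M′ g< pos≡ eq with masters-apart e M M′ pos≡
      ... | inj₁ j≡j′ = j≡j′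
      ... | inj₂ m≤e  = contradiction (cell-mono-< r 0F g<) (≤⇒≯ (≤-trans m≤e (≤-trans (m≤m+n e _)
                          (≤-reflexive (sym (⊕-≡⇒offset (cell g r) (cell g′ r′) e pos≡ eq))))))
      same-tile : j ≡ j′
      same-tile with ⊕-total (pos j) (pos j′)
      ... | inj₁ (e , pos≡) = apart {g = g} {g′} {r} {r′} e M M′ g< pos≡ eq
      ... | inj₂ (e , pos≡) = sym (apart {g = g′} {g} {r′} {r} e M′ M g′< pos≡ (sym eq))
      same-cell : j ≡ j′ → g ≡ g′ × r ≡ r′
      same-cell refl = cell-injective {g} {g′} (⊕-cancelˡ (pos j) eq)

    opaque
      -- Look at the tile covering the first cell after the frame. It is not a slave, and if it is a
      -- master other than j, it starts at least m before or after j; in the former case it is too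
      -- short to get there, in the latter it starts exactly at this cell.
      next : ∀ {j} → IsMaster (K j) → ∃[ j′ ] (IsMaster (K j′) × pos j′ ≡ pos j ⊕ m)
      next {j} M with covered (pos j ⊕ m)
      ... | j′ , g′ , r′ , c′ , eq with master⊎slave (K j′)
      ...   | inj₂ (e , K≡) with piece-hole {j′} {g′} (proj₁ (cell-piece K≡ c′))
      ...     | j″ , g″ , M″ , h , eq′ = ⊥-elim (impossible (trans eq (slide {r = 0F} {0F} r′ r′ refl eq′)))
        where
        g″< : g″ < G
        g″< = proj₂ (hole-bounds (K j″) h)
        c<m : cell g″ r′ < m
        c<m = cell-mono-< r′ 0F g″<
        0<c : 0 < cell g″ r′
        0<c = ≤-<-trans z≤n (cell-mono-< {0} {g″} 0F r′ (<-≤-trans 0<H (≤-trans H≤L (proj₁ (hole-bounds (K j″) h)))))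
        -- A hole lies strictly inside its frame, so the master around the slave would start
        -- strictly between `pos j` and `pos j ⊕ m`.
        impossible : pos j ⊕ m ≡ pos j″ ⊕ cell g″ r′ → ⊥
        impossible eq with ⊕-total (pos j) (pos j″)
        ... | inj₂ (e , pos≡) = contradiction c<m (≤⇒≯ (≤-trans (m≤n+m m e) (≤-reflexive (sym (⊕-≡⇒offset (cell g″ r′) m e pos≡ (sym eq))))))
        ... | inj₁ (e , pos≡) with masters-apart e M M″ pos≡
        ...   | inj₁ refl = contradiction c<m (≤⇒≯ (≤-reflexive (⊕-cancelˡ (pos j) eq)))
        ...   | inj₂ m≤e  = contradiction (m<m+n e 0<c) (≤⇒≯ (≤-trans (≤-reflexive (sym (⊕-≡⇒offset m (cell g″ r′) e pos≡ eq))) m≤e))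
      next {j} M | j′ , g′ , r′ , c′ , eq | inj₁ M′ with ⊕-total (pos j) (pos j′)
      ... | inj₁ (e , pos≡) with masters-apart e M M′ pos≡
      ...   | inj₁ refl = contradiction (⊕-cancelˡ (pos j) eq) (end-free (K j) {g′} M c′)
      ...   | inj₂ m≤e  = j′ , M′ , trans pos≡ (cong (pos j ⊕_) (≤-antisym (≤-trans (m≤m+n e _) (≤-reflexive (sym m≡))) m≤e))
        where
        m≡ : m ≡ e + cell g′ r′
        m≡ = ⊕-≡⇒offset m (cell g′ r′) e pos≡ eq
      next {j} M | j′ , g′ , r′ , c′ , eq | inj₁ M′ | inj₂ (e , pos≡) with masters-apart e M′ M pos≡
      ... | inj₁ refl = contradiction (⊕-cancelˡ (pos j) eq) (end-free (K j) {g′} M c′)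
      ... | inj₂ m≤e  = contradiction (cell-mono-< r′ 0F (cell-bound (K j′) c′)) (≤⇒≯ (begin
        cell (G + G) 0F ≡⟨ cell-+ G G 0F ⟩
        m + m           ≤⟨ +-monoˡ-≤ m m≤e ⟩
        e + m           ≡⟨ ⊕-≡⇒offset (cell g′ r′) m e pos≡ (sym eq) ⟨
        cell g′ r′      ∎))
        where open ≤-Reasoning

    data Located (j : Index) (g : ℕ) (r : Fin 4) : Set where
      inMaster   : Cell (K j) g r → Located j g r
      inTail  : ∀ {j′ y} → IsMaster (K j′) → pos j ≡ pos j′ ⊕ m → y < tail (K j′) → g ≡ H + y → Located j g r
      inPiece : ∀ {j′ g′ e} → K j′ ≡ slave e → g′ ≡ 0 ⊎ g′ ≡ δ e → Hole (K j) g →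
              pos j′ ⊕ cell g′ 0F ≡ pos j ⊕ cell g 0F → r ≢ 2F → Located j g r

    -- A position is in one frame only. Hence a covering slave sits in a hole of this very frame,
    -- and a covering master is j itself or reaches in with its tail; by `next` the latter starts
    -- one frame earlier.
    locate : ∀ {j g r} → IsMaster (K j) → g < G → Located j g r
    locate {j} {g} {r} M g< with covered (pos j ⊕ cell g r)
    ... | j′ , g′ , r′ , c′ , eq with master⊎slave (K j′)
    ...   | inj₂ (e , K≡) with cell-piece K≡ c′
    ...     | P , r′≢2F with piece-hole {j′} {g′} P
    ...       | j″ , g″ , M″ , h , eq′
                with frame-unique {g = g} {g″} {r} {r′} M M″ g< (proj₂ (hole-bounds (K j″) h))
                       (trans eq (slide {r = 0F} {0F} r′ r′ refl eq′))
    ...         | refl , refl , refl = inPiece K≡ (subst (λ k → Piece k g′) K≡ P) h eq′ r′≢2F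
    locate {j} {g} {r} M g< | j′ , g′ , r′ , c′ , eq | inj₁ M′ with cell-slot (K j′) M′ c′
    ... | inj₁ g′< with frame-unique {g = g} {g′} {r} {r′} M M′ g< g′< eq
    ...   | refl , refl , refl = inMaster c′
    locate {j} {g} {r} M g< | j′ , g′ , r′ , c′ , eq | inj₁ M′ | inj₂ (y , y< , refl) with next M′
    ... | j″ , M″ , pos≡ with frame-unique {g = g} {H + y} {r} {r′} M M″ g< H+y<G (begin
          pos j ⊕ cell g r                ≡⟨ eq ⟩
          pos j′ ⊕ cell (G + H + y) r′    ≡⟨ cong (λ g → pos j′ ⊕ cell g r′) (+-assoc G H y) ⟩
          pos j′ ⊕ cell (G + (H + y)) r′  ≡⟨ ⊕-cell (pos j′) G (H + y) r′ ⟨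
          pos j′ ⊕ m ⊕ cell (H + y) r′    ≡⟨ cong (_⊕ cell (H + y) r′) pos≡ ⟨
          pos j″ ⊕ cell (H + y) r′        ∎)
      where
      open ≡-Reasoning
      H+y<G : H + y < G
      H+y<G = +-monoʳ-< H (<-trans (<-≤-trans y< (tail≤W (K j′))) W<H)
    ...   | refl , g≡ , _ = inTail M′ pos≡ y< g≡

    -- The gap ends before L, where the holes begin, so no slave can be there and only a tail
    -- remains.
    gap-filled : ∀ {j y} → IsMaster (K j) → y < gap (K j) →
                 ∃[ j′ ] (IsMaster (K j′) × pos j ≡ pos j′ ⊕ m × y < tail (K j′))
    gap-filled {j} {y} M y< with locate {j} {H + y} {0F} M (+-monoʳ-< H (<-trans (<-≤-trans y< (gap≤W (K j))) W<H))
    ... | inMaster c                    = contradiction c (gap-cell (K j) y<)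
    ... | inTail {j′} M′ pos≡ y′< g≡ = j′ , M′ , pos≡ , subst (_< tail (K j′)) (sym (+-cancelˡ-≡ H y _ g≡)) y′<
    ... | inPiece _ _ h _ _          =
      contradiction (+-monoʳ-< H (<-≤-trans y< (gap≤W (K j)))) (≤⇒≯ (proj₁ (hole-bounds (K j) h)))

    opaque
      -- This is what the `suc` in the length of a gap is for: no gap is empty, and whatever fills
      -- its first slot comes from a master one frame earlier.
      previous : ∀ {j} → IsMaster (K j) → ∃[ j′ ] (IsMaster (K j′) × pos j ≡ pos j′ ⊕ m)
      previous {j} M with gap-filled M (0<gap (K j) M)
      ... | j′ , M′ , pos≡ , _ = j′ , M′ , pos≡

    same-position : ∀ {j j′} → pos j ≡ pos j′ → j ≡ j′
    same-position {j} {j′} pos≡ = clash {g = 0} {0} {0F} {0F} (origin (K j)) (origin (K j′)) (cong (_⊕ cell 0 0F) pos≡)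

    -- A shorter tail would leave a slot of the gap unfilled. A longer one would meet the solid slot
    -- right behind the gap; that slot is still before the first hole, since tails are at most W
    -- long.
    tail≡gap : ∀ {j j′} → IsMaster (K j) → IsMaster (K j′) → pos j′ ≡ pos j ⊕ m → tail (K j) ≡ gap (K j′)
    tail≡gap {j} {j′} M M′ pos≡ = ≤-antisym (≮⇒≥ tail≯gap) (≮⇒≥ tail≮gap)
      where
      tail≮gap : ¬ tail (K j) < gap (K j′)
      tail≮gap t< with gap-filled M′ t<
      ... | j″ , _ , pos≡′ , t<′ with same-position {j} {j″} (⊕-cancelʳ m (trans (sym pos≡) pos≡′))
      ...   | refl = n≮n _ t<′
      tail≯gap : ¬ gap (K j′) < tail (K j)
      tail≯gap g< = <⇒≢ 0<m (⊕-cancelˡ (pos j) (trans (⊕-identityʳ (pos j)) (trans (cong pos same-tile) pos≡)))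
        where
        y = gap (K j′)
        same-tile : j ≡ j′
        same-tile = clash {g = G + H + y} {H + y} {0F} {0F} (tail-cell (K j) g<)
          (beyond-gap-cell (K j′) M′ ≤-refl (<-≤-trans g< (tail≤W (K j)))) (begin
            pos j ⊕ cell (G + H + y) 0F     ≡⟨ cong (λ g → pos j ⊕ cell g 0F) (+-assoc G H y) ⟩
            pos j ⊕ cell (G + (H + y)) 0F   ≡⟨ ⊕-cell (pos j) G (H + y) 0F ⟨
            pos j ⊕ m ⊕ cell (H + y) 0F     ≡⟨ cong (_⊕ cell (H + y) 0F) pos≡ ⟨
            pos j′ ⊕ cell (H + y) 0F        ∎)
          where open ≡-Reasoning

    pos⊕cell0 : ∀ j → pos j ⊕ cell 0 0F ≡ pos j
    pos⊕cell0 j = trans (cong (pos j ⊕_) (cell-zero 0)) (⊕-identityʳ (pos j))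

    -- The two pieces of a slave lie in the same frame, since δ < H.
    slave-in-frame : ∀ {j e} → K j ≡ slave e → ∃[ j′ ] ∃[ g ]
      (IsMaster (K j′) × Left (K j′) g × Right (K j′) (g + δ e) × pos j ≡ pos j′ ⊕ cell g 0F)
    slave-in-frame {j} {e} K≡ with piece-hole {j} {0} (subst (λ k → Piece k 0) (sym K≡) (inj₁ refl))
                                 | piece-hole {j} {δ e} (subst (λ k → Piece k (δ e)) (sym K≡) (inj₂ refl))
    ... | j₁ , g₁ , M₁ , h₁ , eq₁ | j₂ , g₂ , M₂ , h₂ , eq₂ = result same-tile
      where
      pos≡ : pos j ≡ pos j₁ ⊕ cell g₁ 0F
      pos≡ = trans (sym (pos⊕cell0 j)) eq₁
      eq : pos j₁ ⊕ cell (g₁ + δ e) 0F ≡ pos j₂ ⊕ cell g₂ 0F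
      eq = trans (sym (⊕-cell (pos j₁) g₁ (δ e) 0F)) (trans (cong (_⊕ cell (δ e) 0F) (sym pos≡)) eq₂)
      same-tile : j₁ ≡ j₂
      same-tile with ⊕-total (pos j₁) (pos j₂)
      ... | inj₁ (e′ , p≡) with masters-apart e′ M₁ M₂ p≡
      ...   | inj₁ j≡ = j≡
      ...   | inj₂ m≤ = contradiction
        (cell-mono-< 0F 0F (+-mono-<-≤ (proj₂ (hole-bounds (K j₁) h₁)) (≤-trans (<⇒≤ (δ<H e)) (≤-trans H≤L (proj₁ (hole-bounds (K j₂) h₂))))))
        (≤⇒≯ (begin
          cell (G + g₂) 0F     ≡⟨ cell-+ G g₂ 0F ⟩
          m + cell g₂ 0F       ≤⟨ +-monoˡ-≤ (cell g₂ 0F) m≤ ⟩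
          e′ + cell g₂ 0F      ≡⟨ ⊕-≡⇒offset (cell (g₁ + δ e) 0F) (cell g₂ 0F) e′ p≡ eq ⟨
          cell (g₁ + δ e) 0F   ∎))
        where open ≤-Reasoning
      same-tile | inj₂ (e′ , p≡) with masters-apart e′ M₂ M₁ p≡
      ...   | inj₁ j≡ = sym j≡
      ...   | inj₂ m≤ = contradiction (cell-mono-< 0F 0F (proj₂ (hole-bounds (K j₂) h₂)))
        (≤⇒≯ (≤-trans m≤ (≤-trans (m≤m+n e′ _) (≤-reflexive (sym (⊕-≡⇒offset (cell g₂ 0F) (cell (g₁ + δ e) 0F) e′ p≡ (sym eq)))))))
      result : j₁ ≡ j₂ → ∃[ j′ ] ∃[ g ] (IsMaster (K j′) × Left (K j′) g × Right (K j′) (g + δ e) × pos j ≡ pos j′ ⊕ cell g 0F)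
      result refl with cell-injective {g₁ + δ e} {g₂} (⊕-cancelˡ (pos j₁) eq)
      ... | refl , _ with linked-holes (K j₁) {e} h₁ h₂
      ...   | l , r = j₁ , g₁ , M₁ , l , r , pos≡

    opaque
      -- Cell 0 of the hole is not the master's, and tails end before L, so a slave covers it. By
      -- `slave-in-frame` the second piece of a slave is in a right hole, so it is the first piece
      -- that lies here.
      left-filled : ∀ {j g} → IsMaster (K j) → Left (K j) g →
                    ∃[ j′ ] ∃[ e ] (K j′ ≡ slave e × pos j′ ≡ pos j ⊕ cell g 0F × Right (K j) (g + δ e))
      left-filled {j} {g} M l with locate {j} {g} {0F} M (proj₂ (hole-bounds (K j) (inj₁ l)))
      ... | inMaster c with hole-cell (K j) (inj₁ l) c
      ...   | ()
      left-filled {j} {g} M l | inTail {j′} _ _ y< refl =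
        contradiction (+-monoʳ-< H (<-≤-trans y< (tail≤W (K j′)))) (≤⇒≯ (proj₁ (hole-bounds (K j) (inj₁ l))))
      left-filled {j} {g} M l | inPiece {j′} {g′} {e} K≡ P _ eq _ with slave-in-frame {j′} K≡
      ... | j₁ , g₁ , M₁ , l₁ , r₁ , pos≡ with P
      ...   | inj₁ refl with frame-unique {g = g₁} {g} {0F} {0F} M₁ M (proj₂ (hole-bounds (K j₁) (inj₁ l₁))) (proj₂ (hole-bounds (K j) (inj₁ l)))
                               (trans (sym pos≡) (trans (sym (pos⊕cell0 j′)) eq))
      ...     | refl , refl , _ = j′ , e , K≡ , pos≡ , r₁
      left-filled {j} {g} M l | inPiece {j′} {g′} {e} K≡ P _ eq _ | j₁ , g₁ , M₁ , l₁ , r₁ , pos≡ | inj₂ refl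
        with frame-unique {g = g₁ + δ e} {g} {0F} {0F} M₁ M (proj₂ (hole-bounds (K j₁) (inj₂ r₁))) (proj₂ (hole-bounds (K j) (inj₁ l)))
               (trans (sym (⊕-cell (pos j₁) g₁ (δ e) 0F)) (trans (cong (_⊕ cell (δ e) 0F) (sym pos≡)) eq))
      ...     | refl , refl , _ = contradiction r₁ (Left⇒¬Right (K j) l)

    opaque
      some-master : ∃[ j ] IsMaster (K j)
      some-master with covered 0ℤ
      ... | j , g , r , c , _ with master⊎slave (K j)
      ...   | inj₁ M        = j , M
      ...   | inj₂ (e , K≡) with piece-hole {j} {g} (proj₁ (cell-piece K≡ c))
      ...     | j′ , _ , M′ , _ = j′ , M′

    module _ {j u v i d} (K≡ : K j ≡ master u v i d) where
      private
        M : IsMaster (K j)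
        M = subst IsMaster (sym K≡) tt

        opaque
          partner : ∀ (a : Fin (holes i)) → let g = L + toℕ d + toℕ a in
            ∃[ j′ ] ∃[ e ] (K j′ ≡ slave e × pos j′ ≡ pos j ⊕ cell g 0F × Right (K j) (g + δ e))
          partner a = left-filled M (subst (λ k → Left k _) (sym K≡)
            (Master.between (m≤m+n _ (toℕ a)) (+-monoʳ-< (L + toℕ d) (Fin.toℕ<n a))))

          target : ∀ (a : Fin (holes i)) → Σ[ b ∈ Fin (holes i) ] (L + toℕ d + toℕ a + δ (proj₁ (proj₂ (partner a))) ≡ R + toℕ b)
          target a with subst (λ k → Right k (L + toℕ d + toℕ a + δ (proj₁ (proj₂ (partner a))))) K≡ (proj₂ (proj₂ (proj₂ (proj₂ (partner a)))))
          ... | Master.between R≤ <R+i with m≤n⇒∃[o]m+o≡n R≤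
          ...   | o , eq = fromℕ< o<i , trans (sym eq) (cong (R +_) (sym (Fin.toℕ-fromℕ< o<i)))
            where
            o<i : o < holes i
            o<i = +-cancelˡ-< R o (holes i) (≤-<-trans (≤-reflexive eq) <R+i)

        far-cell : ∀ (a : Fin (holes i)) → let j′ , e , _ = partner a in
          Cell (K j′) (δ e) 0F × pos j′ ⊕ cell (δ e) 0F ≡ pos j ⊕ cell (R + toℕ (proj₁ (target a))) 0F
        far-cell a = let j′ , e , K≡′ , pos≡ , _ = partner a ; g = L + toℕ d + toℕ a in
          subst (λ k → Cell k (δ e) 0F) (sym K≡′) (inj₂ refl , λ ()) ,
          trans (cong (_⊕ cell (δ e) 0F) pos≡)
            (trans (⊕-cell (pos j) g (δ e) 0F) (cong (λ g → pos j ⊕ cell g 0F) (proj₂ (target a))))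

        -- Slaves ending in the same right hole overlap, hence are the same tile and start in the
        -- same left hole. Injectivity is enough to obtain a code, the holes being finite in number.
        target-injective : Injective _≡_ _≡_ (proj₁ ∘ target)
        target-injective {a} {a′} b≡b′ = Fin.toℕ-injective (+-cancelˡ-≡ (L + toℕ d) (toℕ a) (toℕ a′)
          (proj₁ (cell-injective {r = 0F} {0F} (⊕-cancelˡ (pos j)
            (trans (sym (position a)) (trans (cong pos same-tile) (position a′)))))))
          where
          position : ∀ a → pos (proj₁ (partner a)) ≡ pos j ⊕ cell (L + toℕ d + toℕ a) 0F
          position a = proj₁ (proj₂ (proj₂ (proj₂ (partner a))))
          same-tile : proj₁ (partner a) ≡ proj₁ (partner a′)
          same-tile = clash {r = 0F} {0F} (proj₁ (far-cell a)) (proj₁ (far-cell a′))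
            (trans (proj₂ (far-cell a))
              (trans (cong (λ b → pos j ⊕ cell (R + toℕ b) 0F) b≡b′) (sym (proj₂ (far-cell a′)))))

      opaque
        frame-at : Σ[ φ ∈ Frame ] (K j ≡ Frame.kind φ ×
                     (∀ a → ∃[ j′ ] (K j′ ≡ slave (Frame.link φ a) × pos j′ ≡ pos j ⊕ cell (Frame.leftHole φ a) 0F)))
        frame-at with injective⇒decode (proj₁ ∘ target) target-injective
        ... | code , decode≡ = φ , K≡ , λ a → let j′ , e , K≡′ , pos≡ , _ = partner a in
            j′ , trans K≡′ (cong slave (link≡ a)) , pos≡
          where
          φ : Frame
          φ = mkFrame i d code
          link≡ : ∀ a → proj₁ (proj₂ (partner a)) ≡ Frame.link φ a
          link≡ a = δ-injective (+-cancelˡ-≡ (Frame.leftHole φ a) _ _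
            (trans (proj₂ (target a)) (trans (cong (λ b → R + toℕ b) (sym (decode≡ a))) (sym (Frame.leftHole-link φ a)))))

    -- Only masters and the slaves starting in left holes are listed. Since the tiling built from φ
    -- consists of exactly these tiles, they determine the whole point, as `system-encode` shows.
    record Decoding : Set where
      field
        shift : ℕ
        shift< : shift < m
        φ : ℤ → Frame
        chained : ∀ f → Frame.outState (φ f) ≡ Frame.inState (φ (f ⊕ 1))
        masterTile : ∀ f → ∃[ j ] (K j ≡ Frame.kind (φ f) × pos j ⊕ shift ≡ join f 0)
        slaveTile : ∀ f a → ∃[ j ] (K j ≡ slave (Frame.link (φ f) a) ×
                                    pos j ⊕ shift ≡ join f (cell (Frame.leftHole (φ f) a) 0F))

    private
      decoding′ : Decoding
      decoding′ with some-master
      ... | j₀ , M₀ with phase (pos j₀)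
      -- One master fixes the phase r; `next` and `previous` then reach a master in every frame.
      ...   | r , f₀ , r< , pos₀≡ = record
        { shift = r
        ; shift< = r<
        ; φ = λ f → proj₁ (frameAt f)
        ; chained = λ f → Fin.toℕ-injective (suc-injective (chained f))
        ; masterTile = λ f → proj₁ (masterAt f) , proj₁ (proj₂ (frameAt f)) , proj₂ (proj₂ (masterAt f))
        ; slaveTile = slaveTile
        }
        where
        MasterAt : ℤ → Set
        MasterAt f = ∃[ j ] (IsMaster (K j) × pos j ⊕ r ≡ join f 0)

        forward : ∀ {f} e → MasterAt f → MasterAt (f ⊕ e)
        forward {f} zero    at = subst MasterAt (sym (⊕-identityʳ f)) at
        forward {f} (suc e) (j , M , eq) with next M
        ... | j′ , M′ , pos≡ = subst MasterAt (⊕-assoc f 1 e) (forward e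
          (j′ , M′ , trans (cong (_⊕ r) pos≡) (trans (⊕-swap (pos j) m r) (trans (cong (_⊕ m) eq) (sym (join-next f 0))))))

        backward : ∀ {f} e → MasterAt (f ⊕ e) → MasterAt f
        backward {f} zero    at = subst MasterAt (⊕-identityʳ f) at
        backward {f} (suc e) at with backward {f ⊕ 1} e (subst MasterAt (sym (⊕-assoc f 1 e)) at)
        ... | j , M , eq with previous M
        ...   | j′ , M′ , pos≡ = j′ , M′ , ⊕-cancelʳ m
          (trans (⊕-swap (pos j′) r m) (trans (cong (_⊕ r) (sym pos≡)) (trans eq (join-next f 0))))

        opaque
          masterAt : ∀ f → MasterAt f
          masterAt f with ⊕-total f₀ f
          ... | inj₁ (e , refl) = forward e (j₀ , M₀ , pos₀≡)
          ... | inj₂ (e , f₀≡)  = backward e (subst MasterAt f₀≡ (j₀ , M₀ , pos₀≡))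

        is-master : ∀ k → IsMaster k → ∃[ u ] ∃[ v ] ∃[ i ] ∃[ d ] k ≡ master u v i d
        is-master (master u v i d) _ = u , v , i , d , refl

        opaque
          frameAt : ∀ f → let j = proj₁ (masterAt f) in
            Σ[ φ ∈ Frame ] (K j ≡ Frame.kind φ ×
              (∀ a → ∃[ j′ ] (K j′ ≡ slave (Frame.link φ a) × pos j′ ≡ pos j ⊕ cell (Frame.leftHole φ a) 0F)))
          frameAt f = frame-at (proj₂ (proj₂ (proj₂ (proj₂ (is-master _ (proj₁ (proj₂ (masterAt f))))))))

        chained : ∀ f → tail (Frame.kind (proj₁ (frameAt f))) ≡ gap (Frame.kind (proj₁ (frameAt (f ⊕ 1))))
        chained f = subst₂ (λ k k′ → tail k ≡ gap k′) (proj₁ (proj₂ (frameAt f))) (proj₁ (proj₂ (frameAt (f ⊕ 1))))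
          (tail≡gap M M′ (⊕-cancelʳ r (trans eq′ (trans (join-next f 0) (trans (cong (_⊕ m) (sym eq)) (⊕-swap _ r m))))))
          where
          M  = proj₁ (proj₂ (masterAt f))
          M′ = proj₁ (proj₂ (masterAt (f ⊕ 1)))
          eq  = proj₂ (proj₂ (masterAt f))
          eq′ = proj₂ (proj₂ (masterAt (f ⊕ 1)))

        slaveTile : ∀ f a → let φ = proj₁ (frameAt f) in
          ∃[ j ] (K j ≡ slave (Frame.link φ a) × pos j ⊕ r ≡ join f (cell (Frame.leftHole φ a) 0F))
        slaveTile f a with proj₂ (proj₂ (frameAt f)) a
        ... | j′ , K≡ , pos≡ = j′ , K≡ , trans (cong (_⊕ r) pos≡) (trans (⊕-swap _ _ r)
          (trans (cong (_⊕ c) (proj₂ (proj₂ (masterAt f)))) (join-⊕ f 0 c)))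
          where c = cell (Frame.leftHole (proj₁ (frameAt f)) a) 0F

    opaque
      decoding : Decoding
      decoding = decoding′

  -- The tiling built from a chained sequence of frames

  module FrameCells (φ : Frame) where
    open Frame φ public using (inState; outState; level; digit; code; leftHole; rightHole; link; leftHole-link) renaming (kind to kindOf)
    open Master inState outState level digit public using (Zone; between; zone; zone-unique)

    -- A right hole is indexed by the left hole it is paired with, so that either sort of hole names
    -- its slave directly.
    data View (g : ℕ) : Set where
      inSolid : ∀ z → z < 9 → Zone z g → (∀ r → T (owned z r)) → View g
      inGap   : ∀ y → y < suc (toℕ inState) → g ≡ H + y → View g
      inLeft  : ∀ a → g ≡ leftHole a → View g
      inRight : ∀ a → g ≡ rightHole (decode code a) → View g

    left-zone : ∀ {g} a → g ≡ leftHole a → Zone 3 g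
    left-zone a refl = between (m≤m+n _ (toℕ a)) (+-monoʳ-< _ (Fin.toℕ<n a))

    right-zone : ∀ {g} b → g ≡ rightHole b → Zone 5 g
    right-zone b refl = between (m≤m+n _ (toℕ b)) (+-monoʳ-< R (Fin.toℕ<n b))

    zone-left : ∀ {g} → Zone 3 g → View g
    zone-left (between ≤g g<) with m≤n⇒∃[o]m+o≡n ≤g
    ... | o , refl = inLeft (fromℕ< o<i) (cong (L + toℕ digit +_) (sym (Fin.toℕ-fromℕ< o<i)))
      where
      o<i : o < holes level
      o<i = +-cancelˡ-< (L + toℕ digit) o (holes level) g<

    zone-right : ∀ {g} → Zone 5 g → View g
    zone-right (between ≤g g<) with m≤n⇒∃[o]m+o≡n ≤g
    ... | o , refl with decode-surjective code (fromℕ< {o} (+-cancelˡ-< R o (holes level) g<))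
    ...   | a , eq = inRight a (cong (R +_) (sym (trans (cong toℕ eq) (Fin.toℕ-fromℕ< _))))

    view : ∀ {g} → g < G → View g
    view {g} g< with zone 7 g g<
    ... | 0 , z<7 , Z = inSolid 0 (<-trans z<7 (<ᵇ⇒< 7 9 _)) Z _
    ... | 1 , _ , between ≤g g<′ = let y , H+y≡g = m≤n⇒∃[o]m+o≡n ≤g in
          inGap y (+-cancelˡ-< H y _ (≤-<-trans (≤-reflexive H+y≡g) g<′)) (sym H+y≡g)
    ... | 2 , z<7 , Z = inSolid 2 (<-trans z<7 (<ᵇ⇒< 7 9 _)) Z _
    ... | 3 , _ , Z = zone-left Z
    ... | 4 , z<7 , Z = inSolid 4 (<-trans z<7 (<ᵇ⇒< 7 9 _)) Z _
    ... | 5 , _ , Z = zone-right Z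
    ... | 6 , z<7 , Z = inSolid 6 (<-trans z<7 (<ᵇ⇒< 7 9 _)) Z _
    ... | suc (suc (suc (suc (suc (suc (suc _)))))) , s≤s (s≤s (s≤s (s≤s (s≤s (s≤s (s≤s ())))))) , _

    zoneNo : ∀ {g} → View g → ℕ
    zoneNo (inSolid z _ _ _) = z
    zoneNo (inGap _ _ _)   = 1
    zoneNo (inLeft _ _)    = 3
    zoneNo (inRight _ _)   = 5

    in-zone : ∀ {g} (V : View g) → Zone (zoneNo V) g
    in-zone (inSolid _ _ Z _)    = Z
    in-zone (inGap y y< refl)    = between (m≤m+n H y) (+-monoʳ-< H y<)
    in-zone (inLeft a g≡)        = left-zone a g≡
    in-zone (inRight a g≡)       = right-zone (decode code a) g≡

    hole-center : ∀ {g} → Zone 3 g ⊎ Zone 5 g → Cell kindOf g 2F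
    hole-center (inj₁ Z) = 3 , <ᵇ⇒< 3 9 _ , Z , _
    hole-center (inj₂ Z) = 5 , <ᵇ⇒< 5 9 _ , Z , _

    slot-view : ∀ {g r} → g < G → Cell kindOf g r →
                Σ[ V ∈ View g ] ((∀ r → T (owned (zoneNo V) r)) ⊎ (r ≡ 2F × (zoneNo V ≡ 3 ⊎ zoneNo V ≡ 5)))
    slot-view {g} {r} g< c with view g<
    ... | V@(inSolid _ _ _ t)    = V , inj₁ t
    ... | inGap y y< refl      = contradiction c (gap-cell kindOf y<)
    ... | V@(inLeft a g≡)      = V , inj₂ (hole-cell kindOf (inj₁ (left-zone a g≡)) c , inj₁ refl)
    ... | V@(inRight a g≡)     = V , inj₂ (hole-cell kindOf (inj₂ (right-zone (decode code a) g≡)) c , inj₂ refl)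

  open FrameCells using (View; inSolid; inGap; inLeft; inRight; view)

  -- The gap of a frame is filled by the tail of the preceding master.
  symbol : ∀ (prev cur : Frame) {g} → View cur g → Fin 4 → Kind
  symbol prev cur (inSolid _ _ _ _) _  = Frame.kind cur
  symbol prev cur (inGap _ _ _)   _  = Frame.kind prev
  symbol prev cur (inLeft a _)    2F = Frame.kind cur
  symbol prev cur (inLeft a _)    _  = slave (Frame.link cur a)
  symbol prev cur (inRight a _)   2F = Frame.kind cur
  symbol prev cur (inRight a _)   _  = slave (Frame.link cur a)

  pred : ℤ → ℤ
  pred f = f ℤ.+ -1ℤ

  opaque
    unfolding _⊕_

    pred-⊕ : ∀ f → pred f ⊕ 1 ≡ f
    pred-⊕ = lem
      where
      lem : ∀ f → f ℤ.+ -1ℤ ℤ.+ ℤ.1ℤ ≡ f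
      lem = solve-∀

    ⊕-pred : ∀ f → pred (f ⊕ 1) ≡ f
    ⊕-pred = lem
      where
      lem : ∀ f → f ℤ.+ ℤ.1ℤ ℤ.+ -1ℤ ≡ f
      lem = solve-∀

  slot : ℤ → ℕ
  slot c = proj₁ (slotOf (offset c))

  corner : ℤ → Fin 4
  corner c = proj₁ (proj₂ (slotOf (offset c)))

  offset≡ : ∀ c → offset c ≡ cell (slot c) (corner c)
  offset≡ c = proj₂ (proj₂ (slotOf (offset c)))

  slot< : ∀ c → slot c < G
  slot< c = cell-cancel-< (corner c) (≤-<-trans (≤-reflexive (sym (offset≡ c))) (offset< c))

  cell-split : ∀ c → c ≡ join (frame c) (cell (slot c) (corner c))
  cell-split c = trans (join-split c) (cong (join (frame c)) (offset≡ c))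

  opaque
    encode : (ℤ → Frame) → Point (size 𝒫)
    encode φ c = index Kind-finite (symbol (φ (pred (frame c))) (φ (frame c)) (view (φ (frame c)) (slot< c)) (corner c))

    -- A tail reaches no further than the next frame.
    encode-local : ∀ φ φ′ c → φ (frame c) ≡ φ′ (frame c) → φ (pred (frame c)) ≡ φ′ (pred (frame c)) →
                   encode φ c ≡ encode φ′ c
    encode-local φ φ′ c = cong₂ λ cur prev →
      index Kind-finite (symbol prev cur (view cur (slot< c)) (corner c))

  Chained : (ℤ → Frame) → Set
  Chained φ = ∀ f → Frame.outState (φ f) ≡ Frame.inState (φ (f ⊕ 1))

  module _ (φ : ℤ → Frame) (chained : Chained φ) where

    -- `nothing` is the master of frame f, and `just a` is the slave that starts in its left hole a.
    Tile : Set
    Tile = Σ[ f ∈ ℤ ] Maybe (Fin (holes (Frame.level (φ f))))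

    start : Tile → ℤ
    start (f , nothing) = join f 0
    start (f , just a)  = join f (cell (Frame.leftHole (φ f) a) 0F)

    kindAt : Tile → Kind
    kindAt (f , nothing) = Frame.kind (φ f)
    kindAt (f , just a)  = slave (Frame.link (φ f) a)

    owner : ∀ f {g} → View (φ f) g → Fin 4 → Tile
    owner f (inSolid _ _ _ _) _  = f , nothing
    owner f (inGap _ _ _)   _  = pred f , nothing
    owner f (inLeft a _)    2F = f , nothing
    owner f (inLeft a _)    _  = f , just a
    owner f (inRight a _)   2F = f , nothing
    owner f (inRight a _)   _  = f , just a

    kindAt-owner : ∀ f {g} (V : View (φ f) g) r → kindAt (owner f V r) ≡ symbol (φ (pred f)) (φ f) V r
    kindAt-owner f (inSolid _ _ _ _) r = refl
    kindAt-owner f (inGap _ _ _)   r = refl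
    kindAt-owner f (inLeft a _)    0F = refl
    kindAt-owner f (inLeft a _)    1F = refl
    kindAt-owner f (inLeft a _)    2F = refl
    kindAt-owner f (inLeft a _)    3F = refl
    kindAt-owner f (inRight a _)   0F = refl
    kindAt-owner f (inRight a _)   1F = refl
    kindAt-owner f (inRight a _)   2F = refl
    kindAt-owner f (inRight a _)   3F = refl

    -- Views contain proofs and are not unique. But zones are disjoint, and inside a block of holes
    -- the slot determines a, on the right because `decode code` is injective.
    owner-unique : ∀ f {g} (V V′ : View (φ f) g) r → owner f V r ≡ owner f V′ r
    owner-unique f V V′ r = go V V′ (zone-unique (in-zone V) (in-zone V′))
      where
      open FrameCells (φ f) hiding (View; inSolid; inGap; inLeft; inRight; view)
      go : ∀ {g} (V V′ : View (φ f) g) → zoneNo V ≡ zoneNo V′ → owner f V r ≡ owner f V′ r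
      go (inSolid _ _ _ _) (inSolid _ _ _ _) _ = refl
      go (inSolid _ _ _ t) (inGap _ _ _)   refl = ⊥-elim (t 0F)
      go (inSolid _ _ _ t) (inLeft _ _)    refl = ⊥-elim (t 0F)
      go (inSolid _ _ _ t) (inRight _ _)   refl = ⊥-elim (t 0F)
      go (inGap _ _ _)   (inSolid _ _ _ t) refl = ⊥-elim (t 0F)
      go (inGap _ _ _)   (inGap _ _ _)   _ = refl
      go (inLeft _ _)    (inSolid _ _ _ t) refl = ⊥-elim (t 0F)
      go (inLeft a g≡)   (inLeft a′ g≡′) _ with Fin.toℕ-injective (+-cancelˡ-≡ (L + toℕ digit) (toℕ a) (toℕ a′) (trans (sym g≡) g≡′))
      go (inLeft a refl) (inLeft a refl) _ | refl = refl
      go (inRight _ _)   (inSolid _ _ _ t) refl = ⊥-elim (t 0F)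
      go (inRight a g≡)  (inRight a′ g≡′) _ with decode-injective code (Fin.toℕ-injective (+-cancelˡ-≡ R (toℕ (decode code a)) (toℕ (decode code a′)) (trans (sym g≡) g≡′)))
      go (inRight a refl) (inRight a refl) _ | refl = refl
      go (inGap _ _ _)   (inLeft _ _)    ()
      go (inGap _ _ _)   (inRight _ _)   ()
      go (inLeft _ _)    (inGap _ _ _)   ()
      go (inLeft _ _)    (inRight _ _)   ()
      go (inRight _ _)   (inGap _ _ _)   ()
      go (inRight _ _)   (inLeft _ _)    ()

    record _∋_ (t : Tile) (c : ℤ) : Set where
      constructor member
      field
        {mslot} : ℕ
        {mcorner} : Fin 4
        inside : Cell (kindAt t) mslot mcorner
        at : c ≡ start t ⊕ cell mslot mcorner

    -- This yields covering, and its converse `∋-owner` yields disjointness: a tile contains a cell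
    -- precisely when it is the owner of that cell.
    owner-∋ : ∀ f {g} (V : View (φ f) g) r → owner f V r ∋ join f (cell g r)
    owner-∋ f V r = go V r
      where
      open FrameCells (φ f) hiding (View; inSolid; inGap; inLeft; inRight; view)
      at-master : ∀ g r → join f (cell g r) ≡ join f 0 ⊕ cell g r
      at-master g r = sym (join-⊕ f 0 (cell g r))
      at-slave : ∀ a g r → join f (cell (leftHole a + g) r) ≡ join f (cell (leftHole a) 0F) ⊕ cell g r
      at-slave a g r = trans (cong (join f) (cell-+ (leftHole a) g r)) (sym (join-⊕ f _ _))
      near : ∀ a r → r ≢ 2F → (_,_ {B = λ f → Maybe (Fin (holes (Frame.level (φ f))))} f (just a)) ∋ join f (cell (leftHole a) r)
      near a r r≢ = member (inj₁ refl , r≢) (trans (cong (λ g → join f (cell g r)) (sym (+-identityʳ (leftHole a)))) (at-slave a 0 r))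
      far : ∀ a r → r ≢ 2F → (_,_ {B = λ f → Maybe (Fin (holes (Frame.level (φ f))))} f (just a)) ∋ join f (cell (rightHole (decode code a)) r)
      far a r r≢ = member (inj₂ refl , r≢) (trans (cong (λ g → join f (cell g r)) (sym (leftHole-link a))) (at-slave a (δ (link a)) r))
      go : ∀ {g} (V : View (φ f) g) r → owner f V r ∋ join f (cell g r)
      go {g} (inSolid z z<9 Z t) r = member (z , z<9 , Z , t r) (at-master g r)
      go (inGap y y< refl) r = member (Master.tail-cell _ _ _ _ y<out) (begin
        join f (cell (H + y) r)                ≡⟨ cong (λ f → join f (cell (H + y) r)) (pred-⊕ f) ⟨
        join (pred f ⊕ 1) (cell (H + y) r)     ≡⟨ join-suc (pred f) (cell (H + y) r) ⟩
        join (pred f) (m + cell (H + y) r)     ≡⟨ cong (join (pred f)) (cell-+ G (H + y) r) ⟨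
        join (pred f) (cell (G + (H + y)) r)   ≡⟨ cong (λ g → join (pred f) (cell g r)) (+-assoc G H y) ⟨
        join (pred f) (cell (G + H + y) r)     ≡⟨ join-⊕ (pred f) 0 _ ⟨
        join (pred f) 0 ⊕ cell (G + H + y) r   ∎)
        where
        open ≡-Reasoning
        -- Chaining makes the preceding tail as long as the gap.
        y<out : y < suc (toℕ (Frame.outState (φ (pred f))))
        y<out = subst (λ u → y < suc (toℕ u))
          (trans (cong (λ f → Frame.inState (φ f)) (sym (pred-⊕ f))) (sym (chained (pred f)))) y<
      go {g} (inLeft a g≡)  2F = member (hole-center (inj₁ (left-zone a g≡))) (at-master g 2F)
      go (inLeft a refl)    0F = near a 0F (λ ())
      go (inLeft a refl)    1F = near a 1F (λ ())
      go (inLeft a refl)    3F = near a 3F (λ ())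
      go {g} (inRight a g≡) 2F = member (hole-center (inj₂ (right-zone (decode code a) g≡))) (at-master g 2F)
      go (inRight a refl)   0F = far a 0F (λ ())
      go (inRight a refl)   1F = far a 1F (λ ())
      go (inRight a refl)   3F = far a 3F (λ ())

    ∋-owner : ∀ {t c} → t ∋ c → ∃[ f ] ∃[ g ] ∃[ r ] Σ[ V ∈ View (φ f) g ]
              (g < G × c ≡ join f (cell g r) × owner f V r ≡ t)
    ∋-owner {f , nothing} (member {g} {r} c at) with Master.cell-slot _ _ _ _ c
    ... | inj₁ g< with FrameCells.slot-view (φ f) g< c
    ...   | V , full-or-hole = f , g , r , V , g< , trans at (join-⊕ f 0 _) , owns V full-or-hole
      where
      owns : (V : View (φ f) g) → (∀ r → T (owned (FrameCells.zoneNo (φ f) V) r)) ⊎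
             (r ≡ 2F × (FrameCells.zoneNo (φ f) V ≡ 3 ⊎ FrameCells.zoneNo (φ f) V ≡ 5)) → owner f V r ≡ (f , nothing)
      owns (inSolid _ _ _ _) _                = refl
      owns (inGap _ _ _)   (inj₁ t)         = ⊥-elim (t 0F)
      owns (inGap _ _ _)   (inj₂ (_ , inj₁ ()))
      owns (inGap _ _ _)   (inj₂ (_ , inj₂ ()))
      owns (inLeft _ _)    (inj₁ t)         = ⊥-elim (t 0F)
      owns (inLeft _ _)    (inj₂ (refl , _)) = refl
      owns (inRight _ _)   (inj₁ t)         = ⊥-elim (t 0F)
      owns (inRight _ _)   (inj₂ (refl , _)) = refl
    ∋-owner {f , nothing} (member {g} {r} c at) | inj₂ (y , y< , refl) =
      f ⊕ 1 , H + y , r , inGap y y<in refl , +-monoʳ-< H y<H , (begin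
        _                                   ≡⟨ at ⟩
        join f 0 ⊕ cell (G + H + y) r       ≡⟨ join-⊕ f 0 _ ⟩
        join f (cell (G + H + y) r)         ≡⟨ cong (λ g → join f (cell g r)) (+-assoc G H y) ⟩
        join f (cell (G + (H + y)) r)       ≡⟨ cong (join f) (cell-+ G (H + y) r) ⟩
        join f (m + cell (H + y) r)         ≡⟨ join-suc f _ ⟨
        join (f ⊕ 1) (cell (H + y) r)       ∎) , cong (_, nothing) (⊕-pred f)
      where
      open ≡-Reasoning
      y<in : y < suc (toℕ (Frame.inState (φ (f ⊕ 1))))
      y<in = subst (λ u → y < suc (toℕ u)) (chained f) y<
      y<H : y < H
      y<H = <-trans (<-≤-trans y< (toℕ<W (Frame.outState (φ f)))) W<H
    ∋-owner {f , just a} (member {g} {r} (inj₁ refl , r≢) at) =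
      f , leftHole a , r , inLeft a refl , proj₂ (hole-bounds (Frame.kind (φ f)) (inj₁ (left-zone a refl))) ,
      (begin
        _                                      ≡⟨ at ⟩
        join f (cell (leftHole a) 0F) ⊕ cell 0 r  ≡⟨ join-⊕ f _ _ ⟩
        join f (cell (leftHole a) 0F + cell 0 r)  ≡⟨ cong (join f) (cell-+ (leftHole a) 0 r) ⟨
        join f (cell (leftHole a + 0) r)       ≡⟨ cong (λ g → join f (cell g r)) (+-identityʳ (leftHole a)) ⟩
        join f (cell (leftHole a) r)           ∎) , owns r r≢
      where
      open ≡-Reasoning
      open FrameCells (φ f) using (leftHole; left-zone)
      owns : ∀ r → r ≢ 2F → owner f (inLeft a refl) r ≡ (f , just a)
      owns 0F _ = refl
      owns 1F _ = refl
      owns 2F r≢ = contradiction refl r≢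
      owns 3F _ = refl
    ∋-owner {f , just a} (member {g} {r} (inj₂ refl , r≢) at) =
      f , rightHole b , r , inRight a refl , proj₂ (hole-bounds (Frame.kind (φ f)) (inj₂ (right-zone b refl))) ,
      (begin
        _                                              ≡⟨ at ⟩
        join f (cell (leftHole a) 0F) ⊕ cell (δ e) r   ≡⟨ join-⊕ f _ _ ⟩
        join f (cell (leftHole a) 0F + cell (δ e) r)   ≡⟨ cong (join f) (cell-+ (leftHole a) (δ e) r) ⟨
        join f (cell (leftHole a + δ e) r)             ≡⟨ cong (λ g → join f (cell g r)) (leftHole-link a) ⟩
        join f (cell (rightHole b) r)                  ∎) , owns r r≢
      where
      open ≡-Reasoning
      open FrameCells (φ f) using (leftHole; rightHole; right-zone; link; leftHole-link; code)
      b = decode code a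
      e = link a
      owns : ∀ r → r ≢ 2F → owner f (inRight a refl) r ≡ (f , just a)
      owns 0F _ = refl
      owns 1F _ = refl
      owns 2F r≢ = contradiction refl r≢
      owns 3F _ = refl

    ownerAt : ℤ → Tile
    ownerAt c = owner (frame c) (view (φ (frame c)) (slot< c)) (corner c)

    ownerAt-∋ : ∀ c → ownerAt c ∋ c
    ownerAt-∋ c = subst (ownerAt c ∋_) (sym (cell-split c)) (owner-∋ (frame c) (view (φ (frame c)) (slot< c)) (corner c))

    ∋-unique : ∀ {t t′ c} → t ∋ c → t′ ∋ c → t ≡ t′
    ∋-unique t∋c t′∋c with ∋-owner t∋c | ∋-owner t′∋c
    ... | f , g , r , V , g< , c≡ , o≡ | f′ , g′ , r′ , V′ , g′< , c≡′ , o≡′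
      with join-injective (cell-mono-< r 0F g<) (cell-mono-< r′ 0F g′<) (trans (sym c≡) c≡′)
    ... | refl , eq with cell-injective {g} {g′} eq
    ...   | refl , refl = trans (sym o≡) (trans (owner-unique f V V′ r) o≡′)

    opaque
      unfolding encode

      encode-∋ : ∀ {t c} → t ∋ c → encode φ c ≡ index Kind-finite (kindAt t)
      encode-∋ {t} {c} t∋c = cong (index Kind-finite)
        (trans (sym (kindAt-owner (frame c) (view (φ (frame c)) (slot< c)) (corner c)))
               (cong kindAt (∋-unique (ownerAt-∋ c) t∋c)))

    private
      proto : Tile → Prototile
      proto t = prototile 𝒫 (index Kind-finite (kindAt t))

    ∋⇒tile : ∀ {t c} → t ∋ c → tile (start t) (proto t) c
    ∋⇒tile {t} (member {g} {r} c at) =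
      ℤ.+ cell g r ,
      subst (λ k → (ℤ.+ cell g r) ∈ elements (protoOf k)) (sym (element-index Kind-finite (kindAt t)))
            (∈-protoOf⁺ (kindAt t) c) ,
      trans at (sym (⊕-def (start t) (cell g r)))

    tile⇒∋ : ∀ {t c} → tile (start t) (proto t) c → t ∋ c
    tile⇒∋ {t} (p , p∈ , at) with ∈-protoOf⁻ _ p∈
    ... | g , r , c , refl = member (subst (λ k → Cell k g r) (element-index Kind-finite (kindAt t)) c)
                                    (trans at (⊕-def (start t) (cell g r)))

    tiling : Tiling 𝒫
    tiling = record
      { Index    = Tile
      ; position = start
      ; kind     = index Kind-finite ∘ kindAt
      ; covers   = λ c → ownerAt c , ∋⇒tile (ownerAt-∋ c)
      ; disjoint = λ p q → ∋-unique (tile⇒∋ p) (tile⇒∋ q)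
      }

    encode-corresponds : CorrespondsTo tiling (encode φ)
    encode-corresponds c k = mk⇔
      (λ { refl → ownerAt c , proj₂ (Tiling.covers tiling c) , sym (encode-∋ (ownerAt-∋ c)) })
      (λ { (t , t∋c , refl) → encode-∋ (tile⇒∋ t∋c) })

  -- Chained sequences of frames and points of the tiling system

  index-injective : ∀ {k k′} → index Kind-finite k ≡ index Kind-finite k′ → k ≡ k′
  index-injective {k} {k′} eq = trans (sym (element-index Kind-finite k))
    (trans (cong (element Kind-finite) eq) (element-index Kind-finite k′))

  -- Holes are matched by position, because their index types agree only once the kinds have been
  -- identified.
  frame-cancel : ∀ ψ ψ′ → Frame.kind ψ ≡ Frame.kind ψ′ →
    (∀ a a′ → Frame.leftHole ψ a ≡ Frame.leftHole ψ′ a′ → Frame.link ψ a ≡ Frame.link ψ′ a′) → ψ ≡ ψ′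
  frame-cancel ψ@(mkFrame i d c) ψ′@(mkFrame i d c′) refl links =
    cong (mkFrame i d) (decode-cancel c c′ λ a → Fin.toℕ-injective (+-cancelˡ-≡ R (toℕ (decode c a)) (toℕ (decode c′ a))
      (trans (sym (Frame.leftHole-link ψ a))
             (trans (cong (λ e → Frame.leftHole ψ a + δ e) (links a a refl)) (Frame.leftHole-link ψ′ a)))))

  -- The first cell of a frame shows its master. Cell 0 of a left hole shows the slave there, whose
  -- width leads to the paired right hole and so reveals the code.
  encode-injective : ∀ φ φ′ → Chained φ → Chained φ′ → ∀ f →
    (∀ {k} → k < m → encode φ (join f k) ≡ encode φ′ (join f k)) → φ f ≡ φ′ f
  encode-injective φ φ′ ch ch′ f agree = frame-cancel (φ f) (φ′ f)
    (index-injective (trans (sym (at-start φ ch)) (trans (agree 0<m) (at-start φ′ ch′))))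
    (λ a a′ eq → slave-injective (index-injective (trans (sym (at-left φ ch a))
      (trans (agree (left<m φ a)) (trans (cong (λ g → encode φ′ (join f (cell g 0F))) eq) (at-left φ′ ch′ a′))))))
    where
    slave-injective : ∀ {e e′} → slave e ≡ slave e′ → e ≡ e′
    slave-injective refl = refl
    at-start : ∀ φ (ch : Chained φ) → encode φ (join f 0) ≡ index Kind-finite (Frame.kind (φ f))
    at-start φ ch = encode-∋ φ ch {f , nothing} (member {mslot = 0} {0F} (origin (Frame.kind (φ f)))
      (trans (sym (⊕-identityʳ (join f 0))) (cong (join f 0 ⊕_) (sym (cell-zero 0)))))
    at-left : ∀ φ (ch : Chained φ) a → encode φ (join f (cell (Frame.leftHole (φ f) a) 0F)) ≡ index Kind-finite (slave (Frame.link (φ f) a))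
    at-left φ ch a = encode-∋ φ ch {f , just a} (member {mslot = 0} {0F} (origin (slave (Frame.link (φ f) a)))
      (trans (sym (⊕-identityʳ _)) (cong (join f (cell (Frame.leftHole (φ f) a) 0F) ⊕_) (sym (cell-zero 0)))))
    left<m : ∀ φ a → cell (Frame.leftHole (φ f) a) 0F < m
    left<m φ a = cell-mono-< 0F 0F (proj₂ (hole-bounds (Frame.kind (φ f)) (inj₁ (FrameCells.left-zone (φ f) a refl))))
      where open import Data.Sum.Base using (inj₁)

  -- The tile owning c for the shifted sequence reappears one frame later for φ, where it contains c
  -- ⊕ m and has the same kind.
  encode-shift : ∀ φ → Chained φ → ∀ c → encode φ (c ⊕ m) ≡ encode (λ f → φ (f ⊕ 1)) c
  encode-shift φ ch c = trans (encode-∋ φ ch {proj₁ t ⊕ 1 , proj₂ t} (shifted t∋c))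
    (trans (cong (index Kind-finite) (kind-shifted t)) (sym (encode-∋ φ⁺ ch⁺ t∋c)))
    where
    φ⁺ : ℤ → Frame
    φ⁺ f = φ (f ⊕ 1)
    ch⁺ : Chained φ⁺
    ch⁺ f = ch (f ⊕ 1)
    t : Tile φ⁺ ch⁺
    t = ownerAt φ⁺ ch⁺ c
    t∋c : _∋_ φ⁺ ch⁺ t c
    t∋c = ownerAt-∋ φ⁺ ch⁺ c
    kind-shifted : ∀ (t : Tile φ⁺ ch⁺) → kindAt φ ch (proj₁ t ⊕ 1 , proj₂ t) ≡ kindAt φ⁺ ch⁺ t
    kind-shifted (f , nothing) = refl
    kind-shifted (f , just a)  = refl
    shifted : ∀ {t} → _∋_ φ⁺ ch⁺ t c → _∋_ φ ch (proj₁ t ⊕ 1 , proj₂ t) (c ⊕ m)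
    shifted {f , nothing} (member {g} {r} inside refl) = member {mslot = g} {r} inside
      (trans (⊕-swap _ _ m) (cong (_⊕ cell g r) (sym (join-next f 0))))
    shifted {f , just a} (member {g} {r} inside refl) = member {mslot = g} {r} inside
      (trans (⊕-swap _ _ m) (cong (_⊕ cell g r) (sym (join-next f _))))

  encode-system : ∀ φ → Chained φ → TilingSystem 𝒫 (encode φ)
  encode-system φ ch = tiling φ ch , encode-corresponds φ ch

  -- The tile that owns `c ⊕ shift` in the tiling built from φ is one of those listed by `Decoding`,
  -- so up to the translation it is also the tile at c in the given tiling.
  system-encode : ∀ {x} → TilingSystem 𝒫 x →
    ∃[ r ] ∃[ φ ] (r < m × Chained φ × (∀ c → x c ≡ encode φ (c ⊕ r)))
  system-encode {x} (τ , corr) = shift , φ , shift< , chained , λ c →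
    let t∋ = ownerAt-∋ φ chained (c ⊕ shift) in trans (symbol≡ t∋) (sym (encode-∋ φ chained t∋))
    where
    open Tiling τ
    open Decoding (decoding τ)
    tile≡ : ∀ t → ∃[ j ] (K τ j ≡ kindAt φ chained t × position j ⊕ shift ≡ start φ chained t)
    tile≡ (f , nothing) = masterTile f
    tile≡ (f , just a)  = slaveTile f a
    symbol≡ : ∀ {t c} → _∋_ φ chained t (c ⊕ shift) → x c ≡ index Kind-finite (kindAt φ chained t)
    symbol≡ {t} {c} (member {g} {r} inside at) with tile≡ t
    ... | j , K≡ , start≡ = Equivalence.from (corr c _) (j , subst (tileAt j) (sym c≡) (cell∈ τ g r (subst (λ k → Cell k g r) (sym K≡) inside)) ,
                              trans (sym (index-element Kind-finite (kind j))) (cong (index Kind-finite) K≡))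
      where
      c≡ : c ≡ position j ⊕ cell g r
      c≡ = ⊕-cancelʳ shift (trans at (trans (cong (_⊕ cell g r) (sym start≡)) (⊕-swap (position j) shift (cell g r))))

-- The symbolic systems

system-≗ : ∀ {𝒫} {x y : Point (size 𝒫)} → x ≗ y → TilingSystem 𝒫 x → TilingSystem 𝒫 y
system-≗ x≗y (τ , corr) = τ , λ i k → mk⇔ (λ y≡ → Equivalence.to (corr i k) (trans (x≗y i) y≡))
                                          (λ t → trans (sym (x≗y i)) (Equivalence.from (corr i k) t))

system-translate : ∀ {𝒫} {x : Point (size 𝒫)} r → TilingSystem 𝒫 x → TilingSystem 𝒫 (λ c → x (c ⊕ r))
system-translate {𝒫} r (τ , corr) = τ′ , λ i k →
  mk⇔ (λ x≡ → let j , i∈ , k≡ = Equivalence.to (corr (i ⊕ r) k) x≡ in j , fromτ i∈ , k≡)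
      (λ { (j , i∈ , k≡) → Equivalence.from (corr (i ⊕ r) k) (j , toτ i∈ , k≡) })
  where
  open Tiling τ
  toτ : ∀ {i j} → tile (position j ⊖ r) (prototile 𝒫 (kind j)) i → tileAt j (i ⊕ r)
  toτ {i} {j} (p , p∈ , refl) = p , p∈ , ⊖-+-⊕ (position j) p r
  fromτ : ∀ {i j} → tileAt j (i ⊕ r) → tile (position j ⊖ r) (prototile 𝒫 (kind j)) i
  fromτ {i} {j} (p , p∈ , eq) = p , p∈ , ⊕-cancelʳ r (trans eq (sym (⊖-+-⊕ (position j) p r)))
  τ′ : Tiling 𝒫
  τ′ = record
    { Index = Index ; position = λ j → position j ⊖ r ; kind = kind
    ; covers = λ i → let j , i∈ = covers (i ⊕ r) in j , fromτ i∈
    ; disjoint = λ p q → disjoint (toτ p) (toτ q) }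

avoiding-translate : ∀ {n F} (y y′ : Point n) t → (∀ c → y′ c ≡ y (c ℤ.+ t)) → Avoiding F y → Avoiding F y′
avoiding-translate y y′ t y′≡ avoid w w∈ i occ = avoid w w∈ (i ℤ.+ t) λ q →
  trans (cong y (lem i t (ℤ.+ toℕ q))) (trans (sym (y′≡ _)) (occ q))
  where
  lem : ∀ i t q → i ℤ.+ t ℤ.+ q ≡ i ℤ.+ q ℤ.+ t
  lem = solve-∀

avoiding-shift : ∀ {n F} (y y′ : Point n) k → (∀ c → y′ c ≡ y (c ⊕ k)) → Avoiding F y → Avoiding F y′
avoiding-shift y y′ k y′≡ = avoiding-translate y y′ (ℤ.+ k) (λ c → trans (y′≡ c) (cong y (sym (⊕-def c k))))

avoiding-unshift : ∀ {n F} (y y′ : Point n) k → (∀ c → y c ≡ y′ (c ⊕ k)) → Avoiding F y → Avoiding F y′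
avoiding-unshift y y′ k y≡ = avoiding-translate y y′ (ℤ.- ℤ.+ k)
  λ c → trans (cong y′ (sym (trans (sym (⊕-def (c ℤ.+ ℤ.- ℤ.+ k) k)) (lem c (ℤ.+ k))))) (sym (y≡ _))
  where
  lem : ∀ c k → c ℤ.+ ℤ.- k ℤ.+ k ≡ c
  lem = solve-∀

σ^-⊕ : ∀ {n} k (x : Point n) c → σ^ k x c ≡ x (c ⊕ k)
σ^-⊕ zero    x c = cong x (sym (⊕-identityʳ c))
σ^-⊕ (suc k) x c = trans (σ^-⊕ k (σ x) c) (cong x (trans (⊕-def (c ⊕ k) 1) (trans (⊕-assoc c k 1) (cong (c ⊕_) (+-comm k 1)))))

-- By system-code the image of code consists, up to translation, of all
-- tilings; code-local and code-cancel make code and its inverse continuous.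
record BlockCode (n : ℕ) (F : List (List (Fin n))) (m : ℕ) (𝒫 : Collection) : Set₁ where
  field
    radius      : ℕ
    code        : ∀ y → Avoiding F y → Point (size 𝒫)
    code-system : ∀ y avoid → TilingSystem 𝒫 (code y avoid)
    system-code : ∀ {x} → TilingSystem 𝒫 x →
      ∃[ r ] ∃[ y ] Σ[ avoid ∈ Avoiding F y ] (r < m × (∀ c → x c ≡ code y avoid (c ⊕ r)))
    code-shift  : ∀ {y y′} avoid avoid′ → (∀ c → y′ c ≡ y (c ⊕ m)) → ∀ c → code y avoid (c ⊕ m) ≡ code y′ avoid′ c
    code-local  : ∀ {y y′} avoid avoid′ c → (∀ b → ∣ b ∣ ≤ ∣ c ∣ + radius → y b ≡ y′ b) →
                  code y avoid c ≡ code y′ avoid′ c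
    code-cancel : ∀ {y y′} avoid avoid′ c →
                  (∀ b → ∣ b ∣ ≤ ∣ c ∣ + radius → code y avoid b ≡ code y′ avoid′ b) → y c ≡ y′ c

module _ {n F m 𝒫} (C : BlockCode n F m 𝒫) where
  open BlockCode C

  -- The image of `code` under the r-th power of the shift; these are the sets T_r of the theorem.
  -- `Lift` puts them into the universe of `TilingSystem`.
  Phase : ℕ → Pred (Point (size 𝒫)) (lsuc 0ℓ)
  Phase r x = Lift (lsuc 0ℓ) (Σ[ y ∈ Point n ] Σ[ avoid ∈ Avoiding F y ] (∀ c → x c ≡ code y avoid (c ⊕ r)))

  phase-system : ∀ {r x} → Phase r x → TilingSystem 𝒫 x
  phase-system {r} (lift (y , avoid , x≡)) =
    system-≗ (λ c → sym (x≡ c)) (system-translate {𝒫} r (code-system y avoid))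

  system-phase : ∀ {x} → TilingSystem 𝒫 x → ∃[ r ] (r < m × Phase r x)
  system-phase x∈ = let r , y , avoid , r< , x≡ = system-code x∈ in r , r< , lift (y , avoid , x≡)

  private
    bound : ∀ r → ℕ
    bound r = r + radius

    ⊕-bound : ∀ {c N} r → ∣ c ∣ ≤ N → ∣ c ⊕ r ∣ + radius ≤ N + bound r
    ⊕-bound {c} {N} r c≤ = ≤-trans (+-monoˡ-≤ radius (≤-trans (∣⊕∣≤ c r) (+-monoˡ-≤ r c≤))) (≤-reflexive (+-assoc N r radius))

  phase-continuous : ∀ {x x′} r N ((lift (y , _)) : Phase r x) ((lift (y′ , _)) : Phase r x′) →
                     Agree (N + bound r) y y′ → Agree N x x′
  phase-continuous r N (lift (y , avoid , x≡)) (lift (y′ , avoid′ , x≡′)) agree c c≤ =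
    trans (x≡ c) (trans (code-local avoid avoid′ (c ⊕ r) (λ b b≤ → agree b (≤-trans b≤ (⊕-bound r c≤)))) (sym (x≡′ c)))

  -- The witnesses are arbitrary, so for x = x′ this says that y is determined by x up to `_≗_`.
  -- Hence a conjugacy may return the witness stored in a membership proof.
  phase-cancel : ∀ {x x′} r N ((lift (y , _)) : Phase r x) ((lift (y′ , _)) : Phase r x′) →
                 Agree (N + bound r) x x′ → Agree N y y′
  phase-cancel {x} {x′} r N (lift (y , avoid , x≡)) (lift (y′ , avoid′ , x≡′)) agree c c≤ =
    code-cancel avoid avoid′ c λ b b≤ → begin
      code y avoid b                ≡⟨ cong (code y avoid) (⊖-⊕ b r) ⟨
      code y avoid (b ⊖ r ⊕ r)      ≡⟨ x≡ (b ⊖ r) ⟨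
      x (b ⊖ r)                     ≡⟨ agree (b ⊖ r) (near b≤) ⟩
      x′ (b ⊖ r)                    ≡⟨ x≡′ (b ⊖ r) ⟩
      code y′ avoid′ (b ⊖ r ⊕ r)    ≡⟨ cong (code y′ avoid′) (⊖-⊕ b r) ⟩
      code y′ avoid′ b              ∎
    where
    open ≡-Reasoning
    near : ∀ {b} → ∣ b ∣ ≤ ∣ c ∣ + radius → ∣ b ⊖ r ∣ ≤ N + bound r
    near {b} b≤ = ≤-trans (∣⊖∣≤ b r) (≤-trans (+-monoˡ-≤ r (≤-trans b≤ (+-monoˡ-≤ radius c≤)))
      (≤-reflexive (trans (+-assoc N radius r) (cong (N +_) (+-comm radius r)))))

  -- The approximants of x have preimages that agree on growing windows by `phase-cancel`. The
  -- diagonal sequence y collects their stable values; forbidden words and values of the code are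
  -- local, so they may be checked on a single approximant.
  phase-closed : ∀ r → Closed (Phase r)
  phase-closed r x limit = lift (y , avoid , x≡)
    where
    x∈ : ∀ N → Phase r (proj₁ (limit N))
    x∈ N = proj₁ (proj₂ (limit N))
    yᴺ : ℕ → Point n
    yᴺ N = proj₁ (Lift.lower (x∈ N))
    y : Point n
    y c = yᴺ (∣ c ∣ + bound r) c
    y-agree : ∀ N M → N + bound r ≤ M → Agree N y (yᴺ M)
    y-agree N M N≤M c c≤ = phase-cancel r ∣ c ∣ (x∈ (∣ c ∣ + bound r)) (x∈ M)
      (λ b b≤ → trans (sym (proj₂ (proj₂ (limit (∣ c ∣ + bound r))) b b≤))
                      (proj₂ (proj₂ (limit M)) b (≤-trans b≤ (≤-trans (+-monoˡ-≤ (bound r) c≤) N≤M)))) c ≤-refl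
    avoid : Avoiding F y
    avoid w w∈ i occ = proj₁ (proj₂ (Lift.lower (x∈ M))) w w∈ i λ q →
      trans (sym (y-agree N M ≤-refl (i ℤ.+ ℤ.+ toℕ q) (≤-trans (ℤ.∣i+j∣≤∣i∣+∣j∣ i (ℤ.+ toℕ q)) (+-monoʳ-≤ ∣ i ∣ (<⇒≤ (Fin.toℕ<n q)))))) (occ q)
      where
      N M : ℕ
      N = ∣ i ∣ + length w
      M = N + bound r
    x≡ : ∀ c → x c ≡ code y avoid (c ⊕ r)
    x≡ c = trans (proj₂ (proj₂ (limit M)) c (≤-trans (m≤m+n ∣ c ∣ _) (m≤m+n (∣ c ∣ + bound r) _)))
      (phase-continuous r ∣ c ∣ (x∈ M) (lift (y , avoid , λ _ → refl))
        (λ b b≤ → sym (y-agree (∣ c ∣ + bound r) M ≤-refl b b≤)) c ≤-refl)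
      where
      M : ℕ
      -- One `bound r` for the letters that the code reads near c, another for the agreement of y
      -- with the approximant on all of these.
      M = ∣ c ∣ + bound r + bound r

  phase-suc : ∀ r → σ[ Phase r ] ≐ Phase (suc r)
  phase-suc r =
    (λ { (x , lift (y , avoid , x≡) , z≡) → lift (y , avoid , λ c →
           trans (sym (z≡ c)) (trans (x≡ _) (cong (code y avoid) (step c)))) }) ,
    (λ { (lift (y , avoid , z≡)) → (λ c → code y avoid (c ⊕ r)) , lift (y , avoid , λ _ → refl) , λ c →
           trans (cong (code y avoid) (step c)) (sym (z≡ c)) })
    where
    step : ∀ c → c ℤ.+ 1ℤ ⊕ r ≡ c ⊕ suc r
    step c = trans (cong (_⊕ r) (⊕-def c 1)) (⊕-assoc c 1 r)

  -- By `code-shift` a translation by a whole frame can be absorbed into y, in either direction.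
  phase-period : Phase m ≐ Phase 0
  phase-period =
    (λ { (lift (y , avoid , x≡)) →
      let avoid′ = avoiding-shift y (λ c → y (c ⊕ m)) m (λ _ → refl) avoid in
      lift ((λ c → y (c ⊕ m)) , avoid′ , λ c → trans (x≡ c)
        (trans (code-shift avoid avoid′ (λ _ → refl) c) (cong (code _ avoid′) (sym (⊕-identityʳ c))))) }) ,
    (λ { (lift (y , avoid , x≡)) →
      let y≡ = λ c → cong y (sym (⊕-⊖ c m)) ; avoid′ = avoiding-unshift y (λ c → y (c ⊖ m)) m y≡ avoid in
      lift ((λ c → y (c ⊖ m)) , avoid′ , λ c → trans (x≡ c)
        (trans (cong (code y avoid) (⊕-identityʳ c)) (sym (code-shift avoid′ avoid y≡ c)))) })

  phase-conjugate : ∀ {ℓ} {S : Pred (Point n) ℓ} → S ≐ Avoiding F → ∀ r →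
                    Conjugate (σ^ m) S (σ^ m) (Phase r)
  phase-conjugate {S = S} (S⊆ , S⊇) r = record
    { f-maps = f-maps
    ; g-maps = λ { x (lift (y , avoid , x≡)) → lift (σ^ m y , avoiding-shift y (σ^ m y) m (σ^-⊕ m y) avoid , λ c →
        trans (σ^-⊕ m x c) (trans (x≡ (c ⊕ m)) (trans (cong (code y avoid) (⊕-swap c m r))
          (code-shift avoid _ (σ^-⊕ m y) (c ⊕ r))))) }
    ; to = to
    ; from = from
    ; to∘from = λ { (x , lift (y , avoid , x≡)) c → trans (code-local _ avoid (c ⊕ r) (λ _ _ → refl)) (sym (x≡ c)) }
    ; from∘to = λ _ _ → refl
    ; to-continuous = λ x N → N + bound r , λ y → phase-continuous r N (proj₂ (to x)) (proj₂ (to y))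
    ; from-continuous = λ x N → N + bound r , λ y → phase-cancel r N (proj₂ x) (proj₂ y)
    ; commutes = λ y y∈S c → trans (sym (code-shift (S⊆ y∈S) _ (σ^-⊕ m y) (c ⊕ r)))
        (trans (cong (code y (S⊆ y∈S)) (⊕-swap c r m)) (sym (σ^-⊕ m (proj₁ (to (y , y∈S))) c)))
    }
    where
    f-maps : ∀ y → S y → S (σ^ m y)
    f-maps y y∈S = S⊇ (avoiding-shift y (σ^ m y) m (σ^-⊕ m y) (S⊆ y∈S))
    to : ∃ S → ∃ (Phase r)
    to (y , y∈S) = (λ c → code y (S⊆ y∈S) (c ⊕ r)) , lift (y , S⊆ y∈S , λ _ → refl)
    from : ∃ (Phase r) → ∃ S
    from (x , lift (y , avoid , x≡)) = y , S⊇ avoid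

-- Windows

-- Out of range the value is `nothing`, so an occurrence of a word can be tested without proofs that
-- its positions are in range.
readAt : ∀ {A : Set} {k} → Vec A k → ℕ → Maybe A
readAt []       _       = nothing
readAt (a ∷ as) zero    = just a
readAt (a ∷ as) (suc i) = readAt as i

window : ∀ {A : Set} → (ℤ → A) → ℤ → ∀ k → Vec A k
window y c zero    = []
window y c (suc k) = y c ∷ window y (c ⊕ 1) k

readAt-lookup : ∀ {A : Set} {k} (as : Vec A k) i → readAt as (toℕ i) ≡ just (Vec.lookup as i)
readAt-lookup (a ∷ as) zero    = refl
readAt-lookup (a ∷ as) (suc i) = readAt-lookup as i

module _ {A : Set} where

  window-++ : ∀ (y : ℤ → A) c k l → window y c (k + l) ≡ window y c k ++ window y (c ⊕ k) l
  window-++ y c zero    l = cong (λ c → window y c l) (sym (⊕-identityʳ c))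
  window-++ y c (suc k) l = cong (y c ∷_) (trans (window-++ y (c ⊕ 1) k l)
    (cong (λ c′ → window y (c ⊕ 1) k ++ window y c′ l) (⊕-assoc c 1 k)))

  read-window : ∀ (y : ℤ → A) c k {i} → i < k → readAt (window y c k) i ≡ just (y (c ⊕ i))
  read-window y c (suc k) {zero}  _        = cong (just ∘ y) (sym (⊕-identityʳ c))
  read-window y c (suc k) {suc i} (s≤s i<) = trans (read-window y (c ⊕ 1) k i<) (cong (just ∘ y) (⊕-assoc c 1 i))

  window-≡ : ∀ (y : ℤ → A) c {k} (as : Vec A k) → (∀ {i} → i < k → just (y (c ⊕ i)) ≡ readAt as i) → window y c k ≡ as
  window-≡ y c []       eq = refl
  window-≡ y c (a ∷ as) eq = cong₂ _∷_
    (just-injective (trans (cong (just ∘ y) (sym (⊕-identityʳ c))) (eq (s≤s z≤n))))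
    (window-≡ y (c ⊕ 1) as λ {i} i< → trans (cong (just ∘ y) (⊕-assoc c 1 i)) (eq (s≤s i<)))

  window-cong : ∀ {y y′ : ℤ → A} {c c′} k → (∀ {i} → i < k → y (c ⊕ i) ≡ y′ (c′ ⊕ i)) → window y c k ≡ window y′ c′ k
  window-cong {y} {y′} {c} {c′} k eq = window-≡ y c (window y′ c′ k) λ i< →
    trans (cong just (eq i<)) (sym (read-window y′ c′ k i<))

  window-cancel : ∀ {y y′ : ℤ → A} {c} k → window y c k ≡ window y′ c k → ∀ {i} → i < k → y (c ⊕ i) ≡ y′ (c ⊕ i)
  window-cancel {y} {y′} {c} k eq {i} i< = just-injective (trans (sym (read-window y c k i<))
    (trans (cong (λ as → readAt as i) eq) (read-window y′ c k i<)))

  window-truncate : ∀ (y : ℤ → A) c {k l} (l≤k : l ≤ k) → truncate l≤k (window y c k) ≡ window y c l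
  window-truncate y c z≤n       = refl
  window-truncate y c (s≤s l≤k) = cong (y c ∷_) (window-truncate y (c ⊕ 1) l≤k)

does⇒ : ∀ {P : Set} (P? : Dec P) → does P? ≡ true → P
does⇒ (yes p) _ = p

-- Words of the shift of finite type as frames

module Coding (n : ℕ) (F : List (List (Fin n))) (k : ℕ) (short : ∀ {w} → w ∈ F → length w ≤ k)
  (ℓ H : ℕ) (0<ℓ : 0 < ℓ) (large : card (Vec-finite (Fin-finite n) k) + k + 4 * ℓ < H) (fits : n ^ cell (H + H) 0F < suc ℓ !) where

  private
    m : ℕ
    m = cell (H + H) 0F

  States : Finite (Vec (Fin n) k)
  States = Vec-finite (Fin-finite n) k

  N : ℕ
  N = card States

  Word : Set
  Word = Vec (Fin n) m

  k≤m : k ≤ m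
  k≤m = begin
    k                ≤⟨ m≤n+m k N ⟩
    N + k            ≤⟨ m≤m+n (N + k) (4 * ℓ) ⟩
    N + k + 4 * ℓ    ≤⟨ <⇒≤ large ⟩
    H                ≤⟨ m≤m+n H H ⟩
    H + H            ≤⟨ m≤m*n (H + H) 4 ⟩
    (H + H) * 4      ≡⟨ cell-zero (H + H) ⟨
    m                ∎
    where open ≤-Reasoning

  Occurs : Vec (Fin n) (m + k) → List (Fin n) → ℕ → Set
  Occurs x w p = ∀ (q : Fin (length w)) → readAt x (p + toℕ q) ≡ just (lookup w q)

  -- Every occurrence starts at an offset below m in some frame, and by `short` it ends within the k
  -- letters after that frame. So `Good` for the windows of all frames is the same as `Avoiding`.
  Good : Vec (Fin n) (m + k) → Set
  Good x = All.All (λ w → ∀ {p} → p < m → ¬ Occurs x w p) F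

  Good? : ∀ x → Dec (Good x)
  Good? x = All.all? (λ w → allUpTo? (λ p → ¬? (Fin.all? λ q → Maybe-≡-dec Fin._≟_ _ _)) m) F

  stateOf : Word → Fin N
  stateOf w = index States (truncate k≤m w)

  Links : Fin N → Fin N → Word → Set
  Links u v w = stateOf w ≡ u × Good (w ++ element States v)

  Links? : ∀ u v w → Dec (Links u v w)
  Links? u v w = (stateOf w Fin.≟ u) ×-dec Good? (w ++ element States v)

  -- A Boolean equation has at most one proof, so a path is determined by its word and paths can be
  -- counted.
  Path : Fin N → Fin N → Set
  Path u v = Σ[ w ∈ Word ] (does (Links? u v w) ≡ true)

  Word-finite : Finite Word
  Word-finite = Vec-finite (Fin-finite n) m

  opaque
    Path-finite : ∀ u v → Finite (Path u v)
    Path-finite u v = Σ-finite Word-finite λ w → ≡true-finite (does (Links? u v w))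

  Path-≡ : ∀ {u v} {P Q : Path u v} → proj₁ P ≡ proj₁ Q → P ≡ Q
  Path-≡ {P = w , p} {.w , q} refl = cong (w ,_) (Decidable⇒UIP.≡-irrelevant Bool._≟_ p q)

  few-paths : ∀ u v → card (Path-finite u v) < suc ℓ !
  few-paths u v = ≤-<-trans (card-≤ (Path-finite u v) Word-finite proj₁ Path-≡)
                            (≤-<-trans (≤-reflexive (card-Vec (Fin-finite n) m)) fits)

  opaque
    numbering : ∀ u v → Σ[ dig ∈ (Fin ℓ → ℕ) ]
                ((∀ i → dig i ≤ holes i) × (Fin (card (Path-finite u v)) ↔ Numeral dig))
    numbering u v = numeral ℓ (card (Path-finite u v)) (few-paths u v)

  dig : Fin N → Fin N → Fin ℓ → ℕ
  dig u v = proj₁ (numbering u v)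

  dig≤ : ∀ u v i → dig u v i ≤ holes i
  dig≤ u v = proj₁ (proj₂ (numbering u v))

  -- In W = N + k the summand N makes room for gaps of lengths 1, ..., N, and k ensures k ≤ m, so
  -- that a state fits into a frame.
  open Tiles N (N + k) ℓ H (m≤m+n N k) 0<ℓ large dig dig≤ hiding (m; Cell; K)
  open Blocks m
  open Frame using (inState; outState)

  toFrame : ∀ {u v} → Path u v → Frame
  toFrame {u} {v} P = let i , d , c = Inverse.to (proj₂ (proj₂ (numbering u v))) (index (Path-finite u v) P) in mkFrame {u} {v} i d c

  fromFrame : (ψ : Frame) → Path (inState ψ) (outState ψ)
  fromFrame (mkFrame {u} {v} i d c) = element (Path-finite u v) (Inverse.from (proj₂ (proj₂ (numbering u v))) (i , d , c))

  toFrame-fromFrame : ∀ ψ → toFrame (fromFrame ψ) ≡ ψ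
  toFrame-fromFrame (mkFrame {u} {v} i d c) = cong (λ (i , d , c) → mkFrame {u} {v} i d c)
    (trans (cong (Inverse.to f) (index-element (Path-finite u v) _)) (Inverse.strictlyInverseˡ f (i , d , c)))
    where f = proj₂ (proj₂ (numbering u v))

  fromFrame-toFrame : ∀ {u v} (P : Path u v) → fromFrame (toFrame P) ≡ P
  fromFrame-toFrame {u} {v} P = trans (cong (element (Path-finite u v)) (Inverse.strictlyInverseʳ f (index (Path-finite u v) P)))
                                      (element-index (Path-finite u v) P)
    where f = proj₂ (proj₂ (numbering u v))

  toFrame-cong : ∀ {u u′ v v′} (P : Path u v) (P′ : Path u′ v′) → u ≡ u′ → v ≡ v′ → proj₁ P ≡ proj₁ P′ → toFrame P ≡ toFrame P′
  toFrame-cong P P′ refl refl w≡ = cong toFrame (Path-≡ w≡)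

  toFrame-cancel : ∀ {u u′ v v′} (P : Path u v) (P′ : Path u′ v′) → toFrame P ≡ toFrame P′ → proj₁ P ≡ proj₁ P′
  toFrame-cancel P P′ eq = trans (cong proj₁ (sym (fromFrame-toFrame P)))
    (trans (cong (λ ψ → proj₁ (fromFrame ψ)) eq) (cong proj₁ (fromFrame-toFrame P′)))

  wordAt : Point n → ℤ → Word
  wordAt y f = window y (join f 0) m

  extended : ∀ y f → wordAt y f ++ element States (stateOf (wordAt y (f ⊕ 1))) ≡ window y (join f 0) (m + k)
  extended y f = begin
    wordAt y f ++ element States (stateOf (wordAt y (f ⊕ 1)))  ≡⟨ cong (wordAt y f ++_) (element-index States _) ⟩
    wordAt y f ++ truncate k≤m (wordAt y (f ⊕ 1))              ≡⟨ cong (wordAt y f ++_) (window-truncate y _ k≤m) ⟩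
    wordAt y f ++ window y (join (f ⊕ 1) 0) k                  ≡⟨ cong (λ c → wordAt y f ++ window y c k) (join-next f 0) ⟩
    wordAt y f ++ window y (join f 0 ⊕ m) k                    ≡⟨ window-++ y (join f 0) m k ⟨
    window y (join f 0) (m + k)                                ∎
    where open ≡-Reasoning

  join0-⊕ : ∀ f i → join f 0 ⊕ i ≡ join f i
  join0-⊕ f i = join-⊕ f 0 i

  avoiding⇒good : ∀ {y} → Avoiding F y → ∀ f → Good (window y (join f 0) (m + k))
  avoiding⇒good {y} avoid f = All.tabulate λ {w} w∈ {p} p< occ → avoid w w∈ (join f 0 ⊕ p) λ q →
    just-injective (trans
      (cong (just ∘ y) (trans (⊕-def (join f 0 ⊕ p) (toℕ q)) (⊕-assoc (join f 0) p (toℕ q))))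
      (trans (sym (read-window y (join f 0) (m + k) (+-mono-<-≤ p< (≤-trans (<⇒≤ (Fin.toℕ<n q)) (short w∈))))) (occ q)))

  good⇒avoiding : ∀ {y} → (∀ f → Good (window y (join f 0) (m + k))) → Avoiding F y
  good⇒avoiding {y} good w w∈ c occ = All.lookup (good (frame c)) w∈ (offset< c) λ q → trans
    (read-window y (join (frame c) 0) (m + k) (+-mono-<-≤ (offset< c) (≤-trans (<⇒≤ (Fin.toℕ<n q)) (short w∈))))
    (cong just (trans (cong y (trans (sym (⊕-assoc (join (frame c) 0) (offset c) (toℕ q)))
      (trans (cong (_⊕ toℕ q) (trans (join0-⊕ (frame c) (offset c)) (sym (join-split c)))) (sym (⊕-def c (toℕ q)))))) (occ q)))

  pathAt : ∀ y → Avoiding F y → ∀ f → Path (stateOf (wordAt y f)) (stateOf (wordAt y (f ⊕ 1)))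
  pathAt y avoid f = wordAt y f , dec-true (Links? _ _ _) (refl , subst Good (sym (extended y f)) (avoiding⇒good avoid f))

  frames : ∀ y → Avoiding F y → ℤ → Frame
  frames y avoid f = toFrame (pathAt y avoid f)

  frames-chained : ∀ y avoid → Chained (frames y avoid)
  frames-chained y avoid f = refl

  opaque
    code : ∀ y → Avoiding F y → Point (size 𝒫)
    code y avoid = encode (frames y avoid)

    code-system : ∀ y avoid → TilingSystem 𝒫 (code y avoid)
    code-system y avoid = encode-system (frames y avoid) (frames-chained y avoid)

    frames-cong : ∀ {y y′} avoid avoid′ f → wordAt y f ≡ wordAt y′ f → wordAt y (f ⊕ 1) ≡ wordAt y′ (f ⊕ 1) →
                  frames y avoid f ≡ frames y′ avoid′ f
    frames-cong {y} {y′} avoid avoid′ f eq eq′ =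
      toFrame-cong (pathAt y avoid f) (pathAt y′ avoid′ f) (cong stateOf eq) (cong stateOf eq′) eq

    -- A symbol depends on the frame of c and the one before it, and each of these two on its own
    -- word and on the state of its successor.
    code-local : ∀ {y y′} avoid avoid′ c →
      wordAt y (pred (frame c)) ≡ wordAt y′ (pred (frame c)) → wordAt y (frame c) ≡ wordAt y′ (frame c) →
      wordAt y (frame c ⊕ 1) ≡ wordAt y′ (frame c ⊕ 1) → code y avoid c ≡ code y′ avoid′ c
    code-local {y} {y′} avoid avoid′ c eq⁻ eq eq⁺ = encode-local (frames y avoid) (frames y′ avoid′) c
      (frames-cong avoid avoid′ (frame c) eq eq⁺)
      (frames-cong avoid avoid′ (pred (frame c)) eq⁻
        (subst (λ f → wordAt y f ≡ wordAt y′ f) (sym (pred-⊕ (frame c))) eq))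

    code-injective : ∀ {y y′} avoid avoid′ f → (∀ {i} → i < m → code y avoid (join f i) ≡ code y′ avoid′ (join f i)) →
                     wordAt y f ≡ wordAt y′ f
    code-injective {y} {y′} avoid avoid′ f agree = toFrame-cancel (pathAt y avoid f) (pathAt y′ avoid′ f)
      (encode-injective (frames y avoid) (frames y′ avoid′) (frames-chained y avoid) (frames-chained y′ avoid′) f agree)

    code-shift : ∀ {y y′} avoid avoid′ → (∀ c → y′ c ≡ y (c ⊕ m)) → ∀ c → code y avoid (c ⊕ m) ≡ code y′ avoid′ c
    code-shift {y} {y′} avoid avoid′ y′≡ c = trans (encode-shift (frames y avoid) (frames-chained y avoid) c)
      (encode-local (λ f → frames y avoid (f ⊕ 1)) (frames y′ avoid′) c (shifted (frame c)) (shifted (pred (frame c))))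
      where
      words≡ : ∀ f → wordAt y (f ⊕ 1) ≡ wordAt y′ f
      words≡ f = window-cong m λ {i} i< → trans (cong y (trans (cong (_⊕ i) (join-next f 0)) (⊕-swap (join f 0) m i))) (sym (y′≡ _))
      shifted : ∀ f → frames y avoid (f ⊕ 1) ≡ frames y′ avoid′ f
      shifted f = toFrame-cong (pathAt y avoid (f ⊕ 1)) (pathAt y′ avoid′ f)
        (cong stateOf (words≡ f)) (cong stateOf (words≡ (f ⊕ 1))) (words≡ f)

    system-code : ∀ {x} → TilingSystem 𝒫 x →
      ∃[ r ] ∃[ y ] Σ[ avoid ∈ Avoiding F y ] (r < m × (∀ c → x c ≡ code y avoid (c ⊕ r)))
    system-code {x} x∈ with system-encode x∈
    ... | r , φ , r< , chained , x≡ = r , y , avoid , r< , λ c → trans (x≡ c)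
      (encode-local φ (frames y avoid) (c ⊕ r) (sym (frames≡ _)) (sym (frames≡ _)))
      where
      path : ∀ f → Path (inState (φ f)) (outState (φ f))
      path f = fromFrame (φ f)
      ω : ℤ → Word
      ω f = proj₁ (path f)
      y : Point n
      y c = Vec.lookup (ω (frame c)) (fromℕ< (offset< c))
      wordAt≡ : ∀ f → wordAt y f ≡ ω f
      wordAt≡ f = window-≡ y (join f 0) (ω f) λ {i} i< → begin
        just (y (join f 0 ⊕ i))          ≡⟨ cong (just ∘ y) (join0-⊕ f i) ⟩
        just (y (join f i))              ≡⟨ readAt-lookup (ω (frame (join f i))) (fromℕ< (offset< (join f i))) ⟨
        readAt (ω (frame (join f i))) (toℕ (fromℕ< (offset< (join f i))))
          ≡⟨ cong₂ (λ f → readAt (ω f)) (frame-join i<) (trans (Fin.toℕ-fromℕ< (offset< (join f i))) (offset-join {f} i<)) ⟩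
        readAt (ω f) i                   ∎
        where open ≡-Reasoning
      links : ∀ f → Links (inState (φ f)) (outState (φ f)) (ω f)
      links f = does⇒ (Links? _ _ _) (proj₂ (path f))
      inState≡ : ∀ f → stateOf (wordAt y f) ≡ inState (φ f)
      inState≡ f = trans (cong stateOf (wordAt≡ f)) (proj₁ (links f))
      outState≡ : ∀ f → stateOf (wordAt y (f ⊕ 1)) ≡ outState (φ f)
      outState≡ f = trans (inState≡ (f ⊕ 1)) (sym (chained f))
      -- As the frames are chained, the state appended to `ω f` is the beginning of the next word,
      -- so the appended word is a window of y.
      avoid : Avoiding F y
      avoid = good⇒avoiding λ f → subst Good
        (trans (cong₂ (λ w v → w ++ element States v) (sym (wordAt≡ f)) (sym (outState≡ f))) (extended y f))
        (proj₂ (links f))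
      frames≡ : ∀ f → frames y avoid f ≡ φ f
      frames≡ f = trans (toFrame-cong (pathAt y avoid f) (path f) (inState≡ f) (outState≡ f) (wordAt≡ f))
                        (toFrame-fromFrame (φ f))

  private
    radius : ℕ
    -- A crude bound: `near-pred` and `near-next` add two offsets and one frame length.
    radius = m + (m + m)

    same-word : ∀ {y y′} N f → (∀ b → ∣ b ∣ ≤ N → y b ≡ y′ b) → (∀ {i} → i < m → ∣ join f i ∣ ≤ N) →
                wordAt y f ≡ wordAt y′ f
    same-word {y} {y′} N f agree near = window-cong m λ {i} i< →
      trans (cong y (join0-⊕ f i)) (trans (agree (join f i) (near i<)) (cong y′ (sym (join0-⊕ f i))))

    module _ (c : ℤ) where

      near-frame : ∀ {i} → i < m → ∣ join (frame c) i ∣ ≤ ∣ c ∣ + radius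
      near-frame {i} i< = begin
        ∣ join (frame c) i ∣                                ≤⟨ ∣join∣≤ (frame c) i (offset c) ⟩
        ∣ join (frame c) (offset c) ∣ + (i + offset c)      ≡⟨ cong (λ b → ∣ b ∣ + (i + offset c)) (join-split c) ⟨
        ∣ c ∣ + (i + offset c)                              ≤⟨ +-monoʳ-≤ ∣ c ∣ (≤-trans (+-mono-≤ (<⇒≤ i<) (<⇒≤ (offset< c))) (m≤n+m (m + m) m)) ⟩
        ∣ c ∣ + radius                                      ∎
        where open ≤-Reasoning

      near-next : ∀ {i} → i < m → ∣ join (frame c ⊕ 1) i ∣ ≤ ∣ c ∣ + radius
      near-next {i} i< = begin
        ∣ join (frame c ⊕ 1) i ∣                              ≡⟨ cong ∣_∣ (join-suc (frame c) i) ⟩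
        ∣ join (frame c) (m + i) ∣                            ≤⟨ ∣join∣≤ (frame c) (m + i) (offset c) ⟩
        ∣ join (frame c) (offset c) ∣ + (m + i + offset c)    ≡⟨ cong₂ _+_ (cong ∣_∣ (sym (join-split c))) (+-assoc m i (offset c)) ⟩
        ∣ c ∣ + (m + (i + offset c))                          ≤⟨ +-monoʳ-≤ ∣ c ∣ (+-monoʳ-≤ m (+-mono-≤ (<⇒≤ i<) (<⇒≤ (offset< c)))) ⟩
        ∣ c ∣ + radius                                        ∎
        where open ≤-Reasoning

      near-pred : ∀ {i} → i < m → ∣ join (pred (frame c)) i ∣ ≤ ∣ c ∣ + radius
      near-pred {i} i< = begin
        ∣ join f i ∣                                    ≤⟨ ∣join∣≤ f i (m + offset c) ⟩
        ∣ join f (m + offset c) ∣ + (i + (m + offset c))  ≡⟨ cong (λ b → ∣ b ∣ + (i + (m + offset c))) c≡ ⟩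
        ∣ c ∣ + (i + (m + offset c))                    ≤⟨ +-monoʳ-≤ ∣ c ∣ (+-mono-≤ (<⇒≤ i<) (+-monoʳ-≤ m (<⇒≤ (offset< c)))) ⟩
        ∣ c ∣ + radius                                  ∎
        where
        open ≤-Reasoning
        f : ℤ
        f = pred (frame c)
        c≡ : join f (m + offset c) ≡ c
        c≡ = trans (sym (join-suc f (offset c))) (trans (cong (λ f → join f (offset c)) (pred-⊕ (frame c))) (sym (join-split c)))

  blockCode : BlockCode n F m 𝒫
  blockCode = record
    { radius      = radius
    ; code        = code
    ; code-system = code-system
    ; system-code = system-code
    ; code-shift  = code-shift
    ; code-local  = λ avoid avoid′ c agree → code-local avoid avoid′ c
        (same-word (∣ c ∣ + radius) (pred (frame c)) agree (near-pred c))
        (same-word (∣ c ∣ + radius) (frame c) agree (near-frame c))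
        (same-word (∣ c ∣ + radius) (frame c ⊕ 1) agree (near-next c))
    ; code-cancel = λ {y} {y′} avoid avoid′ c agree →
        trans (cong y (c≡ c)) (trans
          (window-cancel m (code-injective avoid avoid′ (frame c) (λ i< → agree _ (near-frame c i<))) (offset< c))
          (cong y′ (sym (c≡ c))))
    }
    where
    c≡ : ∀ c → c ≡ join (frame c) 0 ⊕ offset c
    c≡ c = trans (join-split c) (sym (join0-⊕ (frame c) (offset c)))

-- Choice of the constants and the theorem

length≤sum : ∀ {A : Set} {F : List (List A)} {w} → w ∈ F → length w ≤ sum (map length F)
length≤sum {F = v ∷ F} (here refl) = m≤m+n (length v) (sum (map length F))
length≤sum {F = v ∷ F} (there w∈)  = ≤-trans (length≤sum w∈) (m≤n+m _ (length v))

-- With H = W + 4 * ℓ + 1 the frame length is 8 + 8 * W + 32 * ℓ. As W depends only on n and k,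
-- `factorial-dominates` can choose ℓ after it.
words-fit : ∀ n W ℓ → n ^ (8 + 8 * W) * (n ^ 32) ^ ℓ < suc ℓ ! →
            n ^ cell (suc (W + 4 * ℓ) + suc (W + 4 * ℓ)) 0F < suc ℓ !
words-fit n W ℓ fits = ≤-<-trans (≤-reflexive (begin
  n ^ cell (suc (W + 4 * ℓ) + suc (W + 4 * ℓ)) 0F  ≡⟨ cong (n ^_) (trans (cell-zero _) (cells≡ W ℓ)) ⟩
  n ^ (8 + 8 * W + 32 * ℓ)                         ≡⟨ ^-distribˡ-+-* n (8 + 8 * W) (32 * ℓ) ⟩
  n ^ (8 + 8 * W) * n ^ (32 * ℓ)                   ≡⟨ cong (n ^ (8 + 8 * W) *_) (^-*-assoc n 32 ℓ) ⟨
  n ^ (8 + 8 * W) * (n ^ 32) ^ ℓ                   ∎)) fits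
  where
  open ≡-Reasoning
  cells≡ : ∀ W ℓ → (suc (W + 4 * ℓ) + suc (W + 4 * ℓ)) * 4 ≡ 8 + 8 * W + 32 * ℓ
  cells≡ = ℕ-Solver.solve-∀

blockCode-exists : ∀ n (F : List (List (Fin n))) → ∃[ p ] Σ[ 𝒫 ∈ Collection ] BlockCode n F (suc p) 𝒫
blockCode-exists n F with sum (map length F) | (λ {w} → length≤sum {F = F} {w})
... | k | short with factorial-dominates (n ^ (8 + 8 * (card (Vec-finite (Fin-finite n) k) + k))) (n ^ 32)
...   | ℓ , 0<ℓ , fits = package (cell-mono-< {0} {H + H} 0F 0F (s≤s z≤n))
          (Coding.blockCode n F k short ℓ H 0<ℓ ≤-refl (words-fit n W ℓ fits))
  where
  W H : ℕ
  W = card (Vec-finite (Fin-finite n) k) + k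
  H = suc (W + 4 * ℓ)
  package : ∀ {l m 𝒫} → l < m → BlockCode n F m 𝒫 → ∃[ p ] Σ[ 𝒫 ∈ Collection ] BlockCode n F (suc p) 𝒫
  package {m = suc p} {𝒫} _ C = p , 𝒫 , C

mainTheorem1 : ∀ (n : ℕ) {ℓ : Level} (S : Pred (Point n) ℓ) → IsShiftOfFiniteType S →
    Σ[ p ∈ ℕ ] Σ[ 𝒫 ∈ Collection ]
    Σ[ T ∈ (Fin (suc p) → Pred (Point (size 𝒫)) (lsuc 0ℓ)) ]
    ( (TilingSystem 𝒫 ≐ ⋃ (Fin (suc p)) T)
    × (∀ i → Closed (T i))
    × (∀ (i : Fin p) → σ[ T (inject₁ i) ] ≐ T (suc i))
    × (σ[ T (fromℕ p) ] ≐ T zero)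
    × (∀ i → Conjugate (σ^ (suc p)) S (σ^ (suc p)) (T i)) )
mainTheorem1 n S (F , S≐) = p , 𝒫 , (λ i → Phase C (toℕ i)) ,
  ((λ x∈ → let r , r< , x∈r = system-phase C x∈ in fromℕ< r< , subst (λ r → Phase C r _) (sym (Fin.toℕ-fromℕ< r<)) x∈r) ,
   (λ (i , x∈) → phase-system C x∈)) ,
  (λ i → phase-closed C (toℕ i)) ,
  (λ i → subst (λ r → σ[ Phase C r ] ≐ Phase C (suc (toℕ i))) (sym (Fin.toℕ-inject₁ i)) (phase-suc C (toℕ i))) ,
  -- The cycle closes because the shift takes phase p to phase p + 1, the full period, which is
  -- phase 0 again.
  subst (λ r → σ[ Phase C r ] ≐ Phase C 0) (sym (Fin.toℕ-fromℕ p))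
    ((λ x∈ → proj₁ (phase-period C) (proj₁ (phase-suc C p) x∈)) ,
     (λ x∈ → proj₂ (phase-suc C p) (proj₂ (phase-period C) x∈))) ,
  (λ i → phase-conjugate C S≐ (toℕ i))
  where
  p : ℕ
  p = proj₁ (blockCode-exists n F)
  𝒫 : Collection
  𝒫 = proj₁ (proj₂ (blockCode-exists n F))
  C : BlockCode n F (suc p) 𝒫
  C = proj₂ (proj₂ (blockCode-exists n F))
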